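{- The class $\mathsf{KMAlg}$ of KM-algebras is coherent, i.e. any finitely generated subalgebra of a finitely presented member of $\mathsf{KMAlg}$ is finitely presented.
   Context: A KM-algebra is a Heyting algebra $(A,\bot,\land,\lor,\to)$ together with a unary operation $\Box:A\to A$ such that for all $a,b\in A$: $\Box\top=\top$; $\ \Box a\land\Box b=\Box(a\land b)$; $\ a\le\Box a$; $\ \Box a\to a=a$; $\ \Box a\le b\lor(b\to a)$, where $\top:=\bot\to\bot$ and $a\le b$ means $a=a\land b$. $\mathsf{KMAlg}$ is the class (an equational class) of all KM-algebras, in the signature $(\bot,\land,\lor,\to,\Box)$. Subalgebras, finite generation and finite presentation are meant in the usual universal-algebraic sense relative to the variety $\mathsf{KMAlg}$ (finitely presented: isomorphic to a quotient of a finitely generated free KM-algebra by a finitely generated congruence). -}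

module Defs where

open import Algebra.Core using (Op₁; Op₂)
open import Algebra.Definitions using (Congruent₁; Congruent₂)
import Algebra.Lattice.Bundles as Alg
import Algebra.Lattice.Properties.Lattice as AlgLattice
import Algebra.Lattice.Structures as Alg
open import Algebra.Morphism.Definitions using (Homomorphic₀; Homomorphic₁; Homomorphic₂)
open import Data.Fin.Base using (Fin)
open import Data.List.Base using (List)
open import Data.List.Membership.Propositional using (_∈_)
import Data.List.Membership.Setoid as SetoidMembership
open import Data.Nat.Base using (ℕ)
open import Data.Product.Base using (Σ; Σ-syntax; ∃-syntax; _×_; _,_; proj₁; proj₂)
open import Function.Definitions using (Bijective; Congruent)
open import Level using (Level; _⊔_; suc; 0ℓ)
open import Relation.Binary.Bundles using (Setoid)
open import Relation.Binary.Core using (Rel)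
open import Relation.Binary.Definitions using (_Respects_)
open import Relation.Binary.Lattice using (IsHeytingAlgebra; HeytingAlgebra)
import Relation.Binary.Lattice.Properties.HeytingAlgebra as HeytingProperties
import Relation.Binary.Lattice.Properties.Lattice as LatticeProperties
import Relation.Binary.Lattice.Properties.MeetSemilattice as MeetProperties
import Relation.Binary.Reasoning.Setoid as ≈-Reasoning
open import Relation.Binary.Structures using (IsEquivalence)
open import Relation.Unary using (Pred)

private
  variable
    c c′ ℓ ℓ′ p r : Level

record RawKMAlgebra c ℓ : Set (suc (c ⊔ ℓ)) where
  infix  4 _≈_ _≤_
  infixr 5 _⇨_
  infixr 6 _∨_
  infixr 7 _∧_
  infix  8 □_
  field
    Carrier : Set c
    _≈_     : Rel Carrier ℓ
    ⊥       : Carrier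
    _∧_     : Op₂ Carrier
    _∨_     : Op₂ Carrier
    _⇨_     : Op₂ Carrier
    □_      : Op₁ Carrier

  ⊤ : Carrier
  ⊤ = ⊥ ⇨ ⊥

  _≤_ : Rel Carrier ℓ
  x ≤ y = x ≈ x ∧ y

-- Congruence of the Heyting operations follows from isHeytingAlgebra, but
-- congruence of □ with respect to the setoid equality must be required.

record IsKMAlgebra (A : RawKMAlgebra c ℓ) : Set (c ⊔ ℓ) where
  open RawKMAlgebra A
  field
    isHeytingAlgebra : IsHeytingAlgebra _≈_ _≤_ _∨_ _∧_ _⇨_ ⊤ ⊥
    □-cong           : Congruent₁ _≈_ □_
    □-⊤              : □ ⊤ ≈ ⊤
    □-∧              : ∀ x y → □ x ∧ □ y ≈ □ (x ∧ y)
    x≤□x             : ∀ x → x ≤ □ x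
    □x⇨x≈x           : ∀ x → □ x ⇨ x ≈ x
    □x≤y∨y⇨x         : ∀ x y → □ x ≤ y ∨ (y ⇨ x)

record KMAlgebra c ℓ : Set (suc (c ⊔ ℓ)) where
  field
    rawKMAlgebra : RawKMAlgebra c ℓ
    isKMAlgebra  : IsKMAlgebra rawKMAlgebra

  open RawKMAlgebra rawKMAlgebra public
  open IsKMAlgebra isKMAlgebra public

  heytingAlgebra : HeytingAlgebra c ℓ ℓ
  heytingAlgebra = record { isHeytingAlgebra = isHeytingAlgebra }

  open HeytingAlgebra heytingAlgebra public using (setoid)

record IsKMHomomorphism (A : KMAlgebra c ℓ) (B : KMAlgebra c′ ℓ′)
                        (⟦_⟧ : KMAlgebra.Carrier A → KMAlgebra.Carrier B)
                        : Set (c ⊔ ℓ ⊔ ℓ′) where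
  private
    module A = KMAlgebra A
    module B = KMAlgebra B
  field
    cong   : Congruent A._≈_ B._≈_ ⟦_⟧
    ⊥-homo : Homomorphic₀ A.Carrier B.Carrier B._≈_ ⟦_⟧ A.⊥ B.⊥
    ∧-homo : Homomorphic₂ A.Carrier B.Carrier B._≈_ ⟦_⟧ A._∧_ B._∧_
    ∨-homo : Homomorphic₂ A.Carrier B.Carrier B._≈_ ⟦_⟧ A._∨_ B._∨_
    ⇨-homo : Homomorphic₂ A.Carrier B.Carrier B._≈_ ⟦_⟧ A._⇨_ B._⇨_
    □-homo : Homomorphic₁ A.Carrier B.Carrier B._≈_ ⟦_⟧ A.□_ B.□_

infix 4 _≅_

record _≅_ (A : KMAlgebra c ℓ) (B : KMAlgebra c′ ℓ′) : Set (c ⊔ ℓ ⊔ c′ ⊔ ℓ′) where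
  private
    module A = KMAlgebra A
    module B = KMAlgebra B
  field
    ⟦_⟧              : A.Carrier → B.Carrier
    isKMHomomorphism : IsKMHomomorphism A B ⟦_⟧
    bijective        : Bijective A._≈_ B._≈_ ⟦_⟧

-- A purely equational axiomatisation of KM-algebras.  Unlike the adjunction in
-- IsHeytingAlgebra, it is visibly inherited by quotients.

record KMEquations (A : RawKMAlgebra c ℓ) : Set (c ⊔ ℓ) where
  open RawKMAlgebra A
  field
    isLattice : Alg.IsLattice _≈_ _∨_ _∧_
    ⇨-cong    : Congruent₂ _≈_ _⇨_
    □-cong    : Congruent₁ _≈_ □_
    ⊥-min     : ∀ x → ⊥ ≤ x
    ⇨-refl    : ∀ x → x ⇨ x ≈ ⊤
    ⇨-app     : ∀ x y → x ∧ (x ⇨ y) ≈ x ∧ y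
    ⇨-drop    : ∀ x y → y ∧ (x ⇨ y) ≈ y
    ⇨-distrib : ∀ x y z → x ⇨ (y ∧ z) ≈ (x ⇨ y) ∧ (x ⇨ z)
    □-⊤       : □ ⊤ ≈ ⊤
    □-∧       : ∀ x y → □ x ∧ □ y ≈ □ (x ∧ y)
    x≤□x      : ∀ x → x ≤ □ x
    □x⇨x≈x    : ∀ x → □ x ⇨ x ≈ x
    □x≤y∨y⇨x  : ∀ x y → □ x ≤ y ∨ (y ⇨ x)

fromEquations : {A : RawKMAlgebra c ℓ} → KMEquations A → IsKMAlgebra A
fromEquations {A = A} E = record
  { isHeytingAlgebra = record
    { isBoundedLattice = record
      { isLattice = ∨-∧-isOrderTheoreticLattice
      ; maximum   = ≤-⊤
      ; minimum   = ⊥-min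
      }
    ; exponential = λ w x y → transpose w x y , untranspose w x y
    }
  ; □-cong   = □-cong
  ; □-⊤      = □-⊤
  ; □-∧      = □-∧
  ; x≤□x     = x≤□x
  ; □x⇨x≈x   = □x⇨x≈x
  ; □x≤y∨y⇨x = □x≤y∨y⇨x
  }
  where
  open RawKMAlgebra A
  open KMEquations E
  open Alg.IsLattice isLattice using (sym; trans; ∧-congˡ; ∧-congʳ; ∧-assoc; ∧-comm; refl)

  lattice : Alg.Lattice _ _
  lattice = record { isLattice = isLattice }

  open AlgLattice lattice using (∨-∧-isOrderTheoreticLattice)
  open ≈-Reasoning (Alg.Lattice.setoid lattice)

  ≤-⊤ : ∀ x → x ≤ ⊤
  ≤-⊤ x = sym (trans (∧-congˡ (sym (⇨-refl x))) (⇨-drop x x))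

  transpose : ∀ w x y → w ∧ x ≤ y → w ≤ x ⇨ y
  transpose w x y w∧x≤y = begin
    w                                  ≈⟨ ⇨-drop x w ⟨
    w ∧ (x ⇨ w)                        ≈⟨ ∧-congˡ x⇨w≈x⇨w∧x ⟩
    w ∧ (x ⇨ w ∧ x)                    ≈⟨ ∧-congˡ (⇨-cong refl w∧x≤y) ⟩
    w ∧ (x ⇨ (w ∧ x) ∧ y)              ≈⟨ ∧-congˡ (⇨-distrib x (w ∧ x) y) ⟩
    w ∧ ((x ⇨ w ∧ x) ∧ (x ⇨ y))        ≈⟨ ∧-assoc _ _ _ ⟨
    (w ∧ (x ⇨ w ∧ x)) ∧ (x ⇨ y)        ≈⟨ ∧-congʳ (∧-congˡ x⇨w≈x⇨w∧x) ⟨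
    (w ∧ (x ⇨ w)) ∧ (x ⇨ y)            ≈⟨ ∧-congʳ (⇨-drop x w) ⟩
    w ∧ (x ⇨ y)                        ∎
    where
    x⇨w≈x⇨w∧x : x ⇨ w ≈ x ⇨ w ∧ x
    x⇨w≈x⇨w∧x = begin
      x ⇨ w              ≈⟨ ≤-⊤ (x ⇨ w) ⟩
      (x ⇨ w) ∧ ⊤        ≈⟨ ∧-congˡ (⇨-refl x) ⟨
      (x ⇨ w) ∧ (x ⇨ x)  ≈⟨ ⇨-distrib x w x ⟨
      x ⇨ w ∧ x          ∎

  untranspose : ∀ w x y → w ≤ x ⇨ y → w ∧ x ≤ y
  untranspose w x y w≤x⇨y = begin
    w ∧ x                ≈⟨ ∧-congʳ w≤x⇨y ⟩
    (w ∧ (x ⇨ y)) ∧ x    ≈⟨ ∧-assoc _ _ _ ⟩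
    w ∧ ((x ⇨ y) ∧ x)    ≈⟨ ∧-congˡ (∧-comm _ _) ⟩
    w ∧ (x ∧ (x ⇨ y))    ≈⟨ ∧-congˡ (⇨-app x y) ⟩
    w ∧ (x ∧ y)          ≈⟨ ∧-assoc _ _ _ ⟨
    (w ∧ x) ∧ y          ∎

toEquations : {A : RawKMAlgebra c ℓ} → IsKMAlgebra A → KMEquations A
toEquations {A = A} isKM = record
  { isLattice = isAlgLattice
  ; ⇨-cong    = HP.⇨-cong
  ; □-cong    = □-cong
  ; ⊥-min     = minimum
  ; ⇨-refl    = λ _ → HP.⇨-unit
  ; ⇨-app     = λ x y → Eq.trans (∧-comm _ _) (Eq.trans HP.⇨-app (∧-comm _ _))
  ; ⇨-drop    = λ x y → Eq.trans (∧-comm _ _) HP.⇨-drop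
  ; ⇨-distrib = HP.⇨-distribˡ-∧
  ; □-⊤       = □-⊤
  ; □-∧       = □-∧
  ; x≤□x      = x≤□x
  ; □x⇨x≈x    = □x⇨x≈x
  ; □x≤y∨y⇨x  = □x≤y∨y⇨x
  }
  where
  open IsKMAlgebra isKM
  H : HeytingAlgebra _ _ _
  H = record { isHeytingAlgebra = isHeytingAlgebra }
  open HeytingAlgebra H using (minimum; lattice; meetSemilattice; module Eq)
  open LatticeProperties lattice using (isAlgLattice)
  open MeetProperties meetSemilattice using (∧-comm)
  module HP = HeytingProperties H

module _ (A : KMAlgebra c ℓ) where
  open KMAlgebra A using (Carrier; _≈_; ⊥; _∧_; _∨_; _⇨_; □_; setoid)

  record Subalgebra p : Set (c ⊔ ℓ ⊔ suc p) where
    field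
      Member   : Pred Carrier p
      respects : Member Respects _≈_
      ⊥-closed : Member ⊥
      ∧-closed : ∀ {x y} → Member x → Member y → Member (x ∧ y)
      ∨-closed : ∀ {x y} → Member x → Member y → Member (x ∨ y)
      ⇨-closed : ∀ {x y} → Member x → Member y → Member (x ⇨ y)
      □-closed : ∀ {x} → Member x → Member (□ x)

  -- Membership in the subalgebra generated by X.

  data Generated (X : Pred Carrier p) : Pred Carrier (c ⊔ ℓ ⊔ p) where
    gen  : ∀ {x} → X x → Generated X x
    resp : ∀ {x y} → x ≈ y → Generated X x → Generated X y
    ⊥-gen : Generated X ⊥
    ∧-gen : ∀ {x y} → Generated X x → Generated X y → Generated X (x ∧ y)
    ∨-gen : ∀ {x y} → Generated X x → Generated X y → Generated X (x ∨ y)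
    ⇨-gen : ∀ {x y} → Generated X x → Generated X y → Generated X (x ⇨ y)
    □-gen : ∀ {x} → Generated X x → Generated X (□ x)

  FinitelyGenerated : Set (c ⊔ ℓ)
  FinitelyGenerated = Σ[ xs ∈ List Carrier ] (∀ x → Generated (λ y → y ∈ₛ xs) x)
    where open SetoidMembership setoid renaming (_∈_ to _∈ₛ_)

  -- The congruence generated by R.

  data Cg (R : Rel Carrier r) : Rel Carrier (c ⊔ ℓ ⊔ r) where
    gen    : ∀ {x y} → R x y → Cg R x y
    incl   : ∀ {x y} → x ≈ y → Cg R x y
    sym    : ∀ {x y} → Cg R x y → Cg R y x
    trans  : ∀ {x y z} → Cg R x y → Cg R y z → Cg R x z
    ∧-cong : ∀ {x y u v} → Cg R x y → Cg R u v → Cg R (x ∧ u) (y ∧ v)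
    ∨-cong : ∀ {x y u v} → Cg R x y → Cg R u v → Cg R (x ∨ u) (y ∨ v)
    ⇨-cong : ∀ {x y u v} → Cg R x y → Cg R u v → Cg R (x ⇨ u) (y ⇨ v)
    □-cong : ∀ {x y} → Cg R x y → Cg R (□ x) (□ y)

subalgebra : (A : KMAlgebra c ℓ) → Subalgebra A p → KMAlgebra (c ⊔ p) ℓ
subalgebra A S = record
  { rawKMAlgebra = record
    { Carrier = Σ Carrier Member
    ; _≈_     = λ x y → proj₁ x ≈ proj₁ y
    ; ⊥       = ⊥ , ⊥-closed
    ; _∧_     = λ (x , x∈S) (y , y∈S) → x ∧ y , ∧-closed x∈S y∈S
    ; _∨_     = λ (x , x∈S) (y , y∈S) → x ∨ y , ∨-closed x∈S y∈S
    ; _⇨_     = λ (x , x∈S) (y , y∈S) → x ⇨ y , ⇨-closed x∈S y∈S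
    ; □_      = λ (x , x∈S) → □ x , □-closed x∈S
    }
  ; isKMAlgebra = fromEquations record
    { isLattice = record
      { isEquivalence = record { refl = L.refl ; sym = L.sym ; trans = L.trans }
      ; ∨-comm        = λ _ _ → L.∨-comm _ _
      ; ∨-assoc       = λ _ _ _ → L.∨-assoc _ _ _
      ; ∨-cong        = L.∨-cong
      ; ∧-comm        = λ _ _ → L.∧-comm _ _
      ; ∧-assoc       = λ _ _ _ → L.∧-assoc _ _ _
      ; ∧-cong        = L.∧-cong
      ; absorptive    = (λ _ _ → L.∨-absorbs-∧ _ _) , (λ _ _ → L.∧-absorbs-∨ _ _)
      }
    ; ⇨-cong    = E.⇨-cong
    ; □-cong    = E.□-cong
    ; ⊥-min     = λ _ → E.⊥-min _
    ; ⇨-refl    = λ _ → E.⇨-refl _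
    ; ⇨-app     = λ _ _ → E.⇨-app _ _
    ; ⇨-drop    = λ _ _ → E.⇨-drop _ _
    ; ⇨-distrib = λ _ _ _ → E.⇨-distrib _ _ _
    ; □-⊤       = E.□-⊤
    ; □-∧       = λ _ _ → E.□-∧ _ _
    ; x≤□x      = λ _ → E.x≤□x _
    ; □x⇨x≈x    = λ _ → E.□x⇨x≈x _
    ; □x≤y∨y⇨x  = λ _ _ → E.□x≤y∨y⇨x _ _
    }
  }
  where
  open KMAlgebra A
  open Subalgebra S
  module E = KMEquations (toEquations isKMAlgebra)
  module L = Alg.IsLattice E.isLattice

infixl 6 _/_

_/_ : (A : KMAlgebra c ℓ) → Rel (KMAlgebra.Carrier A) r → KMAlgebra c (c ⊔ ℓ ⊔ r)
A / R = record
  { rawKMAlgebra = record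
    { Carrier = Carrier
    ; _≈_     = Cg A R
    ; ⊥       = ⊥
    ; _∧_     = _∧_
    ; _∨_     = _∨_
    ; _⇨_     = _⇨_
    ; □_      = □_
    }
  ; isKMAlgebra = fromEquations record
    { isLattice = record
      { isEquivalence = record { refl = incl L.refl ; sym = sym ; trans = trans }
      ; ∨-comm        = λ x y → incl (L.∨-comm x y)
      ; ∨-assoc       = λ x y z → incl (L.∨-assoc x y z)
      ; ∨-cong        = ∨-cong
      ; ∧-comm        = λ x y → incl (L.∧-comm x y)
      ; ∧-assoc       = λ x y z → incl (L.∧-assoc x y z)
      ; ∧-cong        = ∧-cong
      ; absorptive    = (λ x y → incl (L.∨-absorbs-∧ x y)) , (λ x y → incl (L.∧-absorbs-∨ x y))
      }
    ; ⇨-cong    = ⇨-cong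
    ; □-cong    = □-cong
    ; ⊥-min     = λ x → incl (E.⊥-min x)
    ; ⇨-refl    = λ x → incl (E.⇨-refl x)
    ; ⇨-app     = λ x y → incl (E.⇨-app x y)
    ; ⇨-drop    = λ x y → incl (E.⇨-drop x y)
    ; ⇨-distrib = λ x y z → incl (E.⇨-distrib x y z)
    ; □-⊤       = incl E.□-⊤
    ; □-∧       = λ x y → incl (E.□-∧ x y)
    ; x≤□x      = λ x → incl (E.x≤□x x)
    ; □x⇨x≈x    = λ x → incl (E.□x⇨x≈x x)
    ; □x≤y∨y⇨x  = λ x y → incl (E.□x≤y∨y⇨x x y)
    }
  }
  where
  open KMAlgebra A using (Carrier; ⊥; _∧_; _∨_; _⇨_; □_; isKMAlgebra)
  module E = KMEquations (toEquations isKMAlgebra)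
  module L = Alg.IsLattice E.isLattice

infixr 5 _⇨_
infixr 6 _∨_
infixr 7 _∧_
infix  8 □_

data Term (n : ℕ) : Set where
  var : Fin n → Term n
  ⊥   : Term n
  _∧_ : Op₂ (Term n)
  _∨_ : Op₂ (Term n)
  _⇨_ : Op₂ (Term n)
  □_  : Op₁ (Term n)

infix 4 _≋_

-- Derivability in equational logic from KMEquations.  The constructors
-- ⊥-min, x≤□x and □x≤y∨y⇨x are inequalities x ≤ y, i.e. x ≋ x ∧ y.

data _≋_ {n} : Rel (Term n) 0ℓ where
  refl      : ∀ {s} → s ≋ s
  sym       : ∀ {s t} → s ≋ t → t ≋ s
  trans     : ∀ {s t u} → s ≋ t → t ≋ u → s ≋ u
  ∧-cong    : ∀ {s t u v} → s ≋ t → u ≋ v → s ∧ u ≋ t ∧ v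
  ∨-cong    : ∀ {s t u v} → s ≋ t → u ≋ v → s ∨ u ≋ t ∨ v
  ⇨-cong    : ∀ {s t u v} → s ≋ t → u ≋ v → s ⇨ u ≋ t ⇨ v
  □-cong    : ∀ {s t} → s ≋ t → □ s ≋ □ t
  ∧-comm    : ∀ s t → s ∧ t ≋ t ∧ s
  ∧-assoc   : ∀ s t u → (s ∧ t) ∧ u ≋ s ∧ (t ∧ u)
  ∨-comm    : ∀ s t → s ∨ t ≋ t ∨ s
  ∨-assoc   : ∀ s t u → (s ∨ t) ∨ u ≋ s ∨ (t ∨ u)
  ∨-absorbs : ∀ s t → s ∨ (s ∧ t) ≋ s
  ∧-absorbs : ∀ s t → s ∧ (s ∨ t) ≋ s
  ⊥-min     : ∀ s → ⊥ ≋ ⊥ ∧ s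
  ⇨-refl    : ∀ s → s ⇨ s ≋ ⊥ ⇨ ⊥
  ⇨-app     : ∀ s t → s ∧ (s ⇨ t) ≋ s ∧ t
  ⇨-drop    : ∀ s t → t ∧ (s ⇨ t) ≋ t
  ⇨-distrib : ∀ s t u → s ⇨ (t ∧ u) ≋ (s ⇨ t) ∧ (s ⇨ u)
  □-⊤       : □ (⊥ ⇨ ⊥) ≋ ⊥ ⇨ ⊥
  □-∧       : ∀ s t → □ s ∧ □ t ≋ □ (s ∧ t)
  x≤□x      : ∀ s → s ≋ s ∧ □ s
  □x⇨x≈x    : ∀ s → □ s ⇨ s ≋ s
  □x≤y∨y⇨x  : ∀ s t → □ s ≋ □ s ∧ (t ∨ (t ⇨ s))

Free : ℕ → KMAlgebra 0ℓ 0ℓ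
Free n = record
  { rawKMAlgebra = record
    { Carrier = Term n
    ; _≈_     = _≋_
    ; ⊥       = ⊥
    ; _∧_     = _∧_
    ; _∨_     = _∨_
    ; _⇨_     = _⇨_
    ; □_      = □_
    }
  ; isKMAlgebra = fromEquations record
    { isLattice = record
      { isEquivalence = record { refl = refl ; sym = sym ; trans = trans }
      ; ∨-comm        = ∨-comm
      ; ∨-assoc       = ∨-assoc
      ; ∨-cong        = ∨-cong
      ; ∧-comm        = ∧-comm
      ; ∧-assoc       = ∧-assoc
      ; ∧-cong        = ∧-cong
      ; absorptive    = ∨-absorbs , ∧-absorbs
      }
    ; ⇨-cong    = ⇨-cong
    ; □-cong    = □-cong
    ; ⊥-min     = ⊥-min
    ; ⇨-refl    = ⇨-refl
    ; ⇨-app     = ⇨-app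
    ; ⇨-drop    = ⇨-drop
    ; ⇨-distrib = ⇨-distrib
    ; □-⊤       = □-⊤
    ; □-∧       = □-∧
    ; x≤□x      = x≤□x
    ; □x⇨x≈x    = □x⇨x≈x
    ; □x≤y∨y⇨x  = □x≤y∨y⇨x
    }
  }

FinitelyPresented : KMAlgebra c ℓ → Set (c ⊔ ℓ)
FinitelyPresented A =
  ∃[ n ] Σ[ E ∈ List (Term n × Term n) ] A ≅ Free n / (λ s t → (s , t) ∈ E)

-- A finite set of equations amounts to one formula φ over x₁ … xₙ, and
-- coherence amounts to uniform interpolation: for terms ρ₁ … ρₘ over x there
-- is a formula ψ over y₁ … yₘ whose consequences χ(y) are exactly those with
-- φ ≤ χ(ρ).  KM-algebras are complete for finite Kripke frames in which □
-- quantifies over the strict successors; there, a world w of a y-model should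
-- satisfy ψ iff the model is bisimilar at w to one of the form M ↾ ρ with M
-- forcing φ.  Such an M can be taken to consist of pairs of a world and a type
-- (a theory within a finite closed set of formulas), because strict
-- bisimulations preserve depth.  Which types a world carries depends only on
-- its variables and on the types carried by its strict successors, so the
-- formulas describing this solve a system of equations guarded by □, and Löb's
-- axiom provides explicit solutions of such systems.

module Submission where

open import Defs
open import Level using (Level; 0ℓ)
open import Algebra.Lattice.Structures using (IsLattice)
open import Data.Empty using () renaming (⊥ to Empty)
open import Data.Fin.Base using (Fin; zero; suc; splitAt; _↑ˡ_; _↑ʳ_)
import Data.Fin.Properties as Fin
open import Data.List.Base using (List; []; _∷_; _++_; allFin; cartesianProduct; concatMap; downFrom; filter; foldr; length; lookup; map)
import Data.List.Membership.DecPropositional as DecMembership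
open import Data.List.Membership.Propositional using (_∈_; _∉_; find; lose)
open import Data.List.Membership.Propositional.Properties
open import Data.List.Properties using (filter-notAll)
open import Data.List.Relation.Unary.All as All using (All; all?)
open import Data.List.Relation.Unary.All.Properties using (¬All⇒Any¬)
open import Data.List.Relation.Unary.Any as Any using (Any; here; there; any?)
import Data.List.Relation.Unary.Any.Properties as Any
open import Data.Nat.Base as ℕ using (ℕ; zero; suc; s≤s)
open import Data.Nat.Induction using (<-wellFounded)
import Data.Nat.Properties as ℕ
open import Data.Product.Base using (Σ-syntax; ∃-syntax; _×_; _,_; proj₁; proj₂; uncurry)
open import Data.Product.Function.NonDependent.Propositional using (_×-⇔_)
open import Data.Sum.Base as Sum using (_⊎_; inj₁; inj₂; [_,_]′)
open import Data.Sum.Function.Propositional using (_⊎-⇔_)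
open import Data.Unit.Base using (tt) renaming (⊤ to Unit)
import Data.Vec.Functional as V
open import Function.Base using (_∘_; id)
open import Function.Bundles using (_⇔_; mk⇔; module Equivalence)
import Function.Properties.Equivalence as ⇔
open import Induction.WellFounded using (Acc; WellFounded; acc; module Subrelation)
open import Relation.Binary.Construct.Closure.Reflexive using (ReflClosure; [_]; refl)
open import Relation.Binary.Core using (Rel)
open import Relation.Binary.Definitions using (DecidableEquality)
open import Relation.Binary.Lattice using (HeytingAlgebra)
import Relation.Binary.Lattice.Properties.HeytingAlgebra as HeytingProperties
open import Relation.Binary.PropositionalEquality.Core as ≡ using (_≡_; refl)
open import Relation.Nullary.Decidable using (Dec; yes; no; ¬?; _×-dec_; _⊎-dec_; _→-dec_; decidable-stable; map′)
open import Relation.Nullary.Negation using (¬_; contradiction)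
open import Relation.Unary using (Decidable; Pred)

open Equivalence using (to; from)

private
  variable
    k m n : ℕ
    A : Set

-- Terms: decidable equality, substitution, finite meets and joins.

infix 4 _≟_

_≟_ : DecidableEquality (Term n)
var x   ≟ var y   = map′ (≡.cong var) (λ { refl → refl }) (x Fin.≟ y)
⊥       ≟ ⊥       = yes refl
(a ∧ b) ≟ (c ∧ d) = map′ (λ { (refl , refl) → refl }) (λ { refl → refl , refl }) ((a ≟ c) ×-dec (b ≟ d))
(a ∨ b) ≟ (c ∨ d) = map′ (λ { (refl , refl) → refl }) (λ { refl → refl , refl }) ((a ≟ c) ×-dec (b ≟ d))
(a ⇨ b) ≟ (c ⇨ d) = map′ (λ { (refl , refl) → refl }) (λ { refl → refl , refl }) ((a ≟ c) ×-dec (b ≟ d))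
(□ a)   ≟ (□ b)   = map′ (≡.cong □_) (λ { refl → refl }) (a ≟ b)
var _   ≟ ⊥       = no λ ()
var _   ≟ (_ ∧ _) = no λ ()
var _   ≟ (_ ∨ _) = no λ ()
var _   ≟ (_ ⇨ _) = no λ ()
var _   ≟ (□ _)   = no λ ()
⊥       ≟ var _   = no λ ()
⊥       ≟ (_ ∧ _) = no λ ()
⊥       ≟ (_ ∨ _) = no λ ()
⊥       ≟ (_ ⇨ _) = no λ ()
⊥       ≟ (□ _)   = no λ ()
(_ ∧ _) ≟ var _   = no λ ()
(_ ∧ _) ≟ ⊥       = no λ ()
(_ ∧ _) ≟ (_ ∨ _) = no λ ()
(_ ∧ _) ≟ (_ ⇨ _) = no λ ()
(_ ∧ _) ≟ (□ _)   = no λ ()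
(_ ∨ _) ≟ var _   = no λ ()
(_ ∨ _) ≟ ⊥       = no λ ()
(_ ∨ _) ≟ (_ ∧ _) = no λ ()
(_ ∨ _) ≟ (_ ⇨ _) = no λ ()
(_ ∨ _) ≟ (□ _)   = no λ ()
(_ ⇨ _) ≟ var _   = no λ ()
(_ ⇨ _) ≟ ⊥       = no λ ()
(_ ⇨ _) ≟ (_ ∧ _) = no λ ()
(_ ⇨ _) ≟ (_ ∨ _) = no λ ()
(_ ⇨ _) ≟ (□ _)   = no λ ()
(□ _)   ≟ var _   = no λ ()
(□ _)   ≟ ⊥       = no λ ()
(□ _)   ≟ (_ ∧ _) = no λ ()
(□ _)   ≟ (_ ∨ _) = no λ ()
(□ _)   ≟ (_ ⇨ _) = no λ ()

infixl 9 _⟪_⟫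

_⟪_⟫ : Term m → (Fin m → Term n) → Term n
var y   ⟪ ρ ⟫ = ρ y
⊥       ⟪ ρ ⟫ = ⊥
(a ∧ b) ⟪ ρ ⟫ = a ⟪ ρ ⟫ ∧ b ⟪ ρ ⟫
(a ∨ b) ⟪ ρ ⟫ = a ⟪ ρ ⟫ ∨ b ⟪ ρ ⟫
(a ⇨ b) ⟪ ρ ⟫ = a ⟪ ρ ⟫ ⇨ b ⟪ ρ ⟫
(□ a)   ⟪ ρ ⟫ = □ (a ⟪ ρ ⟫)

⋀ ⋁ : List (Term n) → Term n
⋀ = foldr _∧_ (⊥ ⇨ ⊥)
⋁ = foldr _∨_ ⊥

-- Kripke semantics

-- Listing the strict successors makes forcing decidable, so that countermodels are found without
-- excluded middle. `>-wf` is converse well-foundedness, the frame condition of Löb's axiom.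
record Frame : Set₁ where
  field
    World : Set
    succs : World → List World

  infix 4 _<_ _⊑_

  _<_ : Rel World 0ℓ
  _<_ = λ u v → v ∈ succs u

  field
    <-trans : ∀ {u v w} → u < v → v < w → u < w
    >-wf    : WellFounded λ v u → u < v

  _⊑_ : Rel World 0ℓ
  _⊑_ = ReflClosure _<_

  ⊑-trans : ∀ {u v w} → u ⊑ v → v ⊑ w → u ⊑ w
  ⊑-trans refl    q       = q
  ⊑-trans [ p ]   refl    = [ p ]
  ⊑-trans [ p ]   [ q ]   = [ <-trans p q ]

  ⊑-<-trans : ∀ {u v w} → u ⊑ v → v < w → u < w
  ⊑-<-trans refl  q = q
  ⊑-<-trans [ p ] q = <-trans p q

  <-⊑-trans : ∀ {u v w} → u < v → v ⊑ w → u < w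
  <-⊑-trans p refl  = p
  <-⊑-trans p [ q ] = <-trans p q

record Model (n : ℕ) : Set₁ where
  field
    frame : Frame

  open Frame frame public

  field
    Val         : World → Fin n → Set
    Val?        : ∀ w x → Dec (Val w x)
    Val-persist : ∀ {u v x} → u < v → Val u x → Val v x

infix 4 _,_⊩_

_,_⊩_ : (M : Model n) → Model.World M → Term n → Set
M , w ⊩ var x   = Model.Val M w x
M , w ⊩ ⊥       = Empty
M , w ⊩ (a ∧ b) = (M , w ⊩ a) × (M , w ⊩ b)
M , w ⊩ (a ∨ b) = (M , w ⊩ a) ⊎ (M , w ⊩ b)
M , w ⊩ (a ⇨ b) = ∀ v → Model._⊑_ M w v → M , v ⊩ a → M , v ⊩ b
M , w ⊩ (□ a)   = ∀ v → Model._<_ M w v → M , v ⊩ a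

module Forcing (M : Model n) where
  open Model M

  infix 4 _⊩_ _⊩?_

  _⊩_ : World → Term n → Set
  w ⊩ a = M , w ⊩ a

  persist : ∀ a {u v} → u ⊑ v → u ⊩ a → v ⊩ a
  persist a       refl    p        = p
  persist (var x) [ u<v ] p        = Val-persist u<v p
  persist (a ∧ b) u⊑v     (p , q)  = persist a u⊑v p , persist b u⊑v q
  persist (a ∨ b) u⊑v     (inj₁ p) = inj₁ (persist a u⊑v p)
  persist (a ∨ b) u⊑v     (inj₂ q) = inj₂ (persist b u⊑v q)
  persist (a ⇨ b) u⊑v     f        = λ w v⊑w → f w (⊑-trans u⊑v v⊑w)
  persist (□ a)   [ u<v ] f        = λ w v<w → f w (<-trans u<v v<w)

  ∀<? : ∀ {P : World → Set} → (∀ v → Dec (P v)) → ∀ w → Dec (∀ v → w < v → P v)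
  ∀<? P? w = map′ (λ ps v → All.lookup ps) (λ f → All.tabulate (f _)) (all? P? (succs w))

  _⊩?_ : ∀ w a → Dec (w ⊩ a)
  w ⊩? var x   = Val? w x
  w ⊩? ⊥       = no λ ()
  w ⊩? (a ∧ b) = (w ⊩? a) ×-dec (w ⊩? b)
  w ⊩? (a ∨ b) = (w ⊩? a) ⊎-dec (w ⊩? b)
  w ⊩? (a ⇨ b) = map′ (λ { (f , g) _ refl → f ; (f , g) v [ w<v ] → g v w<v })
                      (λ f → f w refl , λ v w<v → f v [ w<v ])
                      (imp? w ×-dec ∀<? imp? w)
    where
    imp? : ∀ v → Dec (v ⊩ a → v ⊩ b)
    imp? v = (v ⊩? a) →-dec (v ⊩? b)
  w ⊩? (□ a)   = ∀<? (_⊩? a) w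

  ¬∀<⇒∃¬ : ∀ {P : World → Set} → (∀ v → Dec (P v)) → ∀ {w} →
           ¬ (∀ v → w < v → P v) → ∃[ v ] w < v × ¬ P v
  ¬∀<⇒∃¬ P? {w} ¬∀ = find (¬All⇒Any¬ P? (succs w) λ ps → ¬∀ λ v → All.lookup ps)

  ¬→⇒ : {P Q : Set} → Dec P → ¬ (P → Q) → P × ¬ Q
  ¬→⇒ (yes p) ¬imp = p , λ q → ¬imp λ _ → q
  ¬→⇒ (no ¬p) ¬imp = contradiction (λ p → contradiction p ¬p) ¬imp

  ⊮□⇒ : ∀ a {w} → ¬ w ⊩ □ a → ∃[ v ] w < v × ¬ v ⊩ a
  ⊮□⇒ a = ¬∀<⇒∃¬ (_⊩? a)

  ⊮⇨⇒ : ∀ a b {w} → ¬ w ⊩ a ⇨ b → ∃[ v ] w ⊑ v × v ⊩ a × ¬ v ⊩ b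
  ⊮⇨⇒ a b {w} ¬ab with (w ⊩? a) →-dec (w ⊩? b)
  ... | no ¬imp = w , refl , ¬→⇒ (w ⊩? a) ¬imp
  ... | yes imp with v , w<v , ¬imp ← ¬∀<⇒∃¬ (λ v → (v ⊩? a) →-dec (v ⊩? b))
                                      (λ f → ¬ab λ { _ refl → imp ; v [ w<v ] → f v w<v }) =
    v , [ w<v ] , ¬→⇒ (v ⊩? a) ¬imp

  -- Climbing through successors that refute `a` stops by `>-wf`, at one above which `a` always
  -- holds. This is why a box obligation can demand `□ a` together with the failure of `a`.
  ⊮□⇒maximal : ∀ a {w} → ¬ w ⊩ □ a → ∃[ v ] w < v × v ⊩ □ a × ¬ v ⊩ a
  ⊮□⇒maximal a {w} = go (>-wf w)
    where
    go : ∀ {w} → Acc (λ v u → u < v) w → ¬ w ⊩ □ a → ∃[ v ] w < v × v ⊩ □ a × ¬ v ⊩ a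
    go (acc rs) ¬□a with v , w<v , ¬a ← ⊮□⇒ a ¬□a with v ⊩? (□ a)
    ... | yes □a = v , w<v , □a , ¬a
    ... | no ¬□a with u , v<u , p ← go (rs w<v) ¬□a = u , <-trans w<v v<u , p

  löb : ∀ a {w} → (∀ v → w < v → v ⊩ □ a → v ⊩ a) → w ⊩ □ a
  löb a {w} = go (>-wf w)
    where
    go : ∀ {w} → Acc (λ v u → u < v) w → (∀ v → w < v → v ⊩ □ a → v ⊩ a) → w ⊩ □ a
    go (acc rs) step v w<v = step v w<v (go (rs w<v) λ u v<u → step u (<-trans w<v v<u))

  ⊩⋀⁺ : ∀ {A : Set} {w} (f : A → Term n) {xs} → (∀ {x} → x ∈ xs → w ⊩ f x) → w ⊩ ⋀ (map f xs)
  ⊩⋀⁺ f {[]}     h = λ _ _ ()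
  ⊩⋀⁺ f {x ∷ xs} h = h (here refl) , ⊩⋀⁺ f (h ∘ there)

  ⊩⋀⁻ : ∀ {A : Set} {w} (f : A → Term n) {xs} → w ⊩ ⋀ (map f xs) → ∀ {x} → x ∈ xs → w ⊩ f x
  ⊩⋀⁻ f (p , ps) (here refl) = p
  ⊩⋀⁻ f (p , ps) (there x∈)  = ⊩⋀⁻ f ps x∈

  ⊩⋁⁺ : ∀ {A : Set} {w} (f : A → Term n) {xs x} → x ∈ xs → w ⊩ f x → w ⊩ ⋁ (map f xs)
  ⊩⋁⁺ f (here refl) p = inj₁ p
  ⊩⋁⁺ f (there x∈)  p = inj₂ (⊩⋁⁺ f x∈ p)

  ⊩⋁⁻ : ∀ {A : Set} {w} (f : A → Term n) {xs} → w ⊩ ⋁ (map f xs) → ∃[ x ] x ∈ xs × w ⊩ f x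
  ⊩⋁⁻ f {x ∷ xs} (inj₁ p) = x , here refl , p
  ⊩⋁⁻ f {x ∷ xs} (inj₂ p) with y , y∈ , q ← ⊩⋁⁻ f p = y , there y∈ , q

  -- Amounts to forcing `(a ⇨ b) ∧ (b ⇨ a)` at `w`. The record keeps `a` and `b` inferable, which
  -- the unfolding forcing relation would not.
  record Agree (w : World) (a b : Term n) : Set where
    constructor agree
    field
      at : ∀ {v} → w ⊑ v → (v ⊩ a) ⇔ (v ⊩ b)

  open Agree public

  module _ {w : World} where

    agree-refl : ∀ {a} → Agree w a a
    agree-refl = agree λ _ → ⇔.refl

    agree-up : ∀ {a b v} → w ⊑ v → Agree w a b → Agree v a b
    agree-up w⊑v e = agree λ v⊑u → at e (⊑-trans w⊑v v⊑u)

    agree-∧ : ∀ {a b c d} → Agree w a b → Agree w c d → Agree w (a ∧ c) (b ∧ d)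
    agree-∧ e f = agree λ w⊑v → at e w⊑v ×-⇔ at f w⊑v

    agree-∨ : ∀ {a b c d} → Agree w a b → Agree w c d → Agree w (a ∨ c) (b ∨ d)
    agree-∨ e f = agree λ w⊑v → at e w⊑v ⊎-⇔ at f w⊑v

    agree-⇨ : ∀ {a b c d} → Agree w a b → Agree w c d → Agree w (a ⇨ c) (b ⇨ d)
    agree-⇨ e f = agree λ w⊑v →
      mk⇔ (λ g u v⊑u b → to   (at f (⊑-trans w⊑v v⊑u)) (g u v⊑u (from (at e (⊑-trans w⊑v v⊑u)) b)))
          (λ g u v⊑u a → from (at f (⊑-trans w⊑v v⊑u)) (g u v⊑u (to   (at e (⊑-trans w⊑v v⊑u)) a)))

    -- This is the sense in which `□` guards: its value at `w` is determined strictly above `w`.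
    agree-□ : ∀ {a b} → (∀ {v} → w < v → Agree v a b) → Agree w (□ a) (□ b)
    agree-□ e = agree λ w⊑v → mk⇔ (λ g u v<u → to   (at (e (⊑-<-trans w⊑v v<u)) refl) (g u v<u))
                                  (λ g u v<u → from (at (e (⊑-<-trans w⊑v v<u)) refl) (g u v<u))

    agree-⋀ : ∀ {A : Set} {f g : A → Term n} → (∀ x → Agree w (f x) (g x)) →
              ∀ xs → Agree w (⋀ (map f xs)) (⋀ (map g xs))
    agree-⋀ e []       = agree-refl
    agree-⋀ e (x ∷ xs) = agree-∧ (e x) (agree-⋀ e xs)

    agree-⋁ : ∀ {A : Set} {f g : A → Term n} → (∀ x → Agree w (f x) (g x)) →
              ∀ xs → Agree w (⋁ (map f xs)) (⋁ (map g xs))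
    agree-⋁ e []       = agree-refl
    agree-⋁ e (x ∷ xs) = agree-∨ (e x) (agree-⋁ e xs)

  agree-≋ : ∀ {w a b} → a ≋ b → Agree w a b
  sound   : ∀ {a b} → a ≋ b → ∀ w → (w ⊩ a) ⇔ (w ⊩ b)
  agree-≋ e = agree λ _ → sound e _

  sound refl              w = ⇔.refl
  sound (sym e)           w = ⇔.sym (sound e w)
  sound (trans e f)       w = ⇔.trans (sound e w) (sound f w)
  sound (∧-cong e f)      w = sound e w ×-⇔ sound f w
  sound (∨-cong e f)      w = sound e w ⊎-⇔ sound f w
  sound (⇨-cong e f)      w = at (agree-⇨ (agree-≋ e) (agree-≋ f)) refl
  sound (□-cong e)        w = at (agree-□ λ _ → agree-≋ e) refl
  sound (∧-comm a b)      w = mk⇔ (λ (p , q) → q , p) (λ (p , q) → q , p)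
  sound (∧-assoc a b c)   w = mk⇔ (λ ((p , q) , r) → p , q , r) (λ (p , q , r) → (p , q) , r)
  sound (∨-comm a b)      w = mk⇔ [ inj₂ , inj₁ ]′ [ inj₂ , inj₁ ]′
  sound (∨-assoc a b c)   w = mk⇔ [ [ inj₁ , inj₂ ∘ inj₁ ]′ , inj₂ ∘ inj₂ ]′
                                  [ inj₁ ∘ inj₁ , [ inj₁ ∘ inj₂ , inj₂ ]′ ]′
  sound (∨-absorbs a b)   w = mk⇔ [ id , proj₁ ]′ inj₁
  sound (∧-absorbs a b)   w = mk⇔ proj₁ (λ p → p , inj₁ p)
  sound (⊥-min a)         w = mk⇔ (λ ()) proj₁
  sound (⇨-refl a)        w = mk⇔ (λ _ _ _ ()) (λ _ _ _ p → p)
  sound (⇨-app a b)       w = mk⇔ (λ (p , f) → p , f w refl p)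
                                  (λ (p , q) → p , λ v w⊑v _ → persist b w⊑v q)
  sound (⇨-drop a b)      w = mk⇔ proj₁ (λ q → q , λ v w⊑v _ → persist b w⊑v q)
  sound (⇨-distrib a b c) w = mk⇔ (λ f → (λ v w⊑v p → proj₁ (f v w⊑v p)) , λ v w⊑v p → proj₂ (f v w⊑v p))
                                  (λ (f , g) v w⊑v p → f v w⊑v p , g v w⊑v p)
  sound □-⊤               w = mk⇔ (λ _ _ _ ()) (λ _ _ _ _ _ ())
  sound (□-∧ a b)         w = mk⇔ (λ (f , g) v w<v → f v w<v , g v w<v)
                                  (λ f → (λ v w<v → proj₁ (f v w<v)) , λ v w<v → proj₂ (f v w<v))
  sound (x≤□x a)          w = mk⇔ (λ p → p , λ v w<v → persist a [ w<v ] p) proj₁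
  sound (□x⇨x≈x a)        w = mk⇔ (λ f → f w refl (löb a λ v w<v → f v [ w<v ]))
                                  (λ p v w⊑v _ → persist a w⊑v p)
  sound (□x≤y∨y⇨x a b)    w = mk⇔ (λ f → f , split f) proj₁
    where
    split : w ⊩ □ a → w ⊩ b ∨ (b ⇨ a)
    -- If `b` fails at `w`, then `b ⇨ a` is at issue only at strict successors, where `□ a` already
    -- gives `a`.
    split f with w ⊩? b
    ... | yes q = inj₁ q
    ... | no ¬q = inj₂ λ { _ refl q → contradiction q ¬q ; v [ w<v ] _ → f v w<v }

-- Splitting a list into two sublists.

splits : List A → List (List A × List A)
splits []       = ([] , []) ∷ []
splits (x ∷ xs) = map (λ (ys , zs) → x ∷ ys , zs) (splits xs) ++
                  map (λ (ys , zs) → ys , x ∷ zs) (splits xs)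

filter∈splits : ∀ {P : Pred A 0ℓ} (P? : Decidable P) xs →
                (filter P? xs , filter (¬? ∘ P?) xs) ∈ splits xs
filter∈splits P? []       = here refl
filter∈splits P? (x ∷ xs) with P? x
... | yes _ = ∈-++⁺ˡ (∈-map⁺ _ (filter∈splits P? xs))
... | no _  = ∈-++⁺ʳ _ (∈-map⁺ _ (filter∈splits P? xs))

∈-splits⁺ : ∀ {x : A} {xs ys zs} → (ys , zs) ∈ splits xs → x ∈ xs → x ∈ ys ⊎ x ∈ zs
∈-splits⁺ {xs = y ∷ xs} s x∈ with ∈-++⁻ (map _ (splits xs)) s
∈-splits⁺ {xs = y ∷ xs} s (here refl) | inj₁ s′ with _ , s″ , refl ← ∈-map⁻ _ s′ = inj₁ (here refl)
∈-splits⁺ {xs = y ∷ xs} s (here refl) | inj₂ s′ with _ , s″ , refl ← ∈-map⁻ _ s′ = inj₂ (here refl)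
∈-splits⁺ {xs = y ∷ xs} s (there x∈)  | inj₁ s′ with _ , s″ , refl ← ∈-map⁻ _ s′ = Sum.map₁ there (∈-splits⁺ s″ x∈)
∈-splits⁺ {xs = y ∷ xs} s (there x∈)  | inj₂ s′ with _ , s″ , refl ← ∈-map⁻ _ s′ = Sum.map₂ there (∈-splits⁺ s″ x∈)

∈-splits⁻ : ∀ {x : A} {xs ys zs} → (ys , zs) ∈ splits xs → x ∈ ys → x ∈ xs
∈-splits⁻ {xs = []}     (here refl) ()
∈-splits⁻ {xs = y ∷ xs} s           x∈ with ∈-++⁻ (map _ (splits xs)) s
... | inj₂ s′ with _ , s″ , refl ← ∈-map⁻ _ s′ = there (∈-splits⁻ s″ x∈)
... | inj₁ s′ with ∈-map⁻ _ s′
∈-splits⁻ {xs = y ∷ xs} s (here refl) | inj₁ s′ | _ , s″ , refl = here refl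
∈-splits⁻ {xs = y ∷ xs} s (there x∈)  | inj₁ s′ | _ , s″ , refl = there (∈-splits⁻ s″ x∈)

-- Types

infix 4 _∈?_

_∈?_ : (a : Term n) (Γ : List (Term n)) → Dec (a ∈ Γ)
_∈?_ = DecMembership._∈?_ _≟_

args : Term n → List (Term n)
args (var _) = []
args ⊥       = []
args (a ∧ b) = a ∷ b ∷ []
args (a ∨ b) = a ∷ b ∷ []
args (a ⇨ b) = a ∷ b ∷ []
args (□ a)   = a ∷ []

Closed : List (Term n) → Set
Closed cl = ∀ {a b} → a ∈ cl → b ∈ args a → b ∈ cl

-- The conditions on a theory that can be checked at one world. What concerns its successors, such
-- as all of `□`, is left to `⊆⁺` and `demands`.
Coherent : List (Term n) → Term n → Set
Coherent Γ (var _) = Unit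
Coherent Γ ⊥       = ⊥ ∉ Γ
Coherent Γ (a ∧ b) = (a ∧ b ∈ Γ → a ∈ Γ × b ∈ Γ) × (a ∈ Γ × b ∈ Γ → a ∧ b ∈ Γ)
Coherent Γ (a ∨ b) = (a ∨ b ∈ Γ → a ∈ Γ ⊎ b ∈ Γ) × (a ∈ Γ ⊎ b ∈ Γ → a ∨ b ∈ Γ)
Coherent Γ (a ⇨ b) = (a ⇨ b ∈ Γ → a ∈ Γ → b ∈ Γ) × (a ∈ Γ → b ∈ Γ → a ⇨ b ∈ Γ)
Coherent Γ (□ _)   = Unit

coherent? : ∀ Γ (a : Term n) → Dec (Coherent Γ a)
coherent? Γ (var _) = yes tt
coherent? Γ ⊥       = ¬? (⊥ ∈? Γ)
coherent? Γ (a ∧ b) = ((a ∧ b ∈? Γ) →-dec ((a ∈? Γ) ×-dec (b ∈? Γ))) ×-dec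
                      (((a ∈? Γ) ×-dec (b ∈? Γ)) →-dec (a ∧ b ∈? Γ))
coherent? Γ (a ∨ b) = ((a ∨ b ∈? Γ) →-dec ((a ∈? Γ) ⊎-dec (b ∈? Γ))) ×-dec
                      (((a ∈? Γ) ⊎-dec (b ∈? Γ)) →-dec (a ∨ b ∈? Γ))
coherent? Γ (a ⇨ b) = ((a ⇨ b ∈? Γ) →-dec ((a ∈? Γ) →-dec (b ∈? Γ))) ×-dec
                      ((a ∈? Γ) →-dec ((b ∈? Γ) →-dec (a ⇨ b ∈? Γ)))
coherent? Γ (□ _)   = yes tt

unbox : Term n → List (Term n)
unbox (□ a) = a ∷ []
unbox _     = []

∈-unbox⁻ : ∀ {a} (b : Term n) → a ∈ unbox b → b ≡ □ a
∈-unbox⁻ (□ a) (here refl) = refl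

infix 8 _⁺

-- What a strict successor of a world of type `Γ` must force: `Γ` itself by persistence, and `a` for
-- each `□ a` in `Γ`.
_⁺ : List (Term n) → List (Term n)
Γ ⁺ = Γ ++ concatMap unbox Γ

infix 4 _⊆⁺_ _⊆⁺?_

_⊆⁺_ : Rel (List (Term n)) 0ℓ
Γ ⊆⁺ Δ = All (_∈ Δ) (Γ ⁺)

_⊆⁺?_ : (Γ Δ : List (Term n)) → Dec (Γ ⊆⁺ Δ)
Γ ⊆⁺? Δ = all? (_∈? Δ) (Γ ⁺)

module _ {Γ : List (Term n)} where

  ∈⁺-self : ∀ {a} → a ∈ Γ → a ∈ Γ ⁺
  ∈⁺-self = ∈-++⁺ˡ

  ∈⁺-unbox : ∀ {a} → □ a ∈ Γ → a ∈ Γ ⁺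
  ∈⁺-unbox □a∈Γ = ∈-++⁺ʳ Γ (∈-concatMap⁺ unbox (lose □a∈Γ (here refl)))

  ∈⁺⁻ : ∀ {a} → a ∈ Γ ⁺ → a ∈ Γ ⊎ □ a ∈ Γ
  ∈⁺⁻ a∈ with ∈-++⁻ Γ a∈
  ... | inj₁ a∈Γ = inj₁ a∈Γ
  ... | inj₂ a∈′ with b , b∈Γ , p ← find (∈-concatMap⁻ unbox {xs = Γ} a∈′)
                 with refl ← ∈-unbox⁻ b p = inj₂ b∈Γ

⊆⁺-trans : {Γ Δ Θ : List (Term n)} → Γ ⊆⁺ Δ → Δ ⊆⁺ Θ → Γ ⊆⁺ Θ
⊆⁺-trans Γ⊆Δ Δ⊆Θ = All.map (λ a∈Δ → All.lookup Δ⊆Θ (∈⁺-self a∈Δ)) Γ⊆Δ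

-- An obligation (c , p , q) says that a world refuting c has a strict
-- successor forcing p and refuting q, unless the world already forces p.

obligations : Term n → List (Term n × Term n × Term n)
obligations (a ⇨ b) = (a ⇨ b , a , b) ∷ []
obligations (□ a)   = (□ a , □ a , a) ∷ []
obligations _       = []

data Obligation {n} : Term n × Term n × Term n → Set where
  imp : ∀ {a b} → Obligation (a ⇨ b , a , b)
  box : ∀ {a} → Obligation (□ a , □ a , a)

Open : List (Term n) → Term n × Term n × Term n → Set
Open Γ (c , p , _) = c ∉ Γ × p ∉ Γ

open? : ∀ Γ (o : Term n × Term n × Term n) → Dec (Open Γ o)
open? Γ (c , p , _) = ¬? (c ∈? Γ) ×-dec ¬? (p ∈? Γ)

demands : List (Term n) → List (Term n) → List (Term n × Term n × Term n)
demands cl Γ = filter (open? Γ) (concatMap obligations cl)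

∈-demands⁺ : ∀ {cl Γ : List (Term n)} {c p q} → c ∈ cl → Obligation (c , p , q) →
             c ∉ Γ → p ∉ Γ → (c , p , q) ∈ demands cl Γ
∈-demands⁺ {Γ = Γ} c∈ imp c∉ p∉ = ∈-filter⁺ (open? Γ) (∈-concatMap⁺ obligations (lose c∈ (here refl))) (c∉ , p∉)
∈-demands⁺ {Γ = Γ} c∈ box c∉ p∉ = ∈-filter⁺ (open? Γ) (∈-concatMap⁺ obligations (lose c∈ (here refl))) (c∉ , p∉)

∈-demands⁻ : ∀ {cl Γ : List (Term n)} {o} → o ∈ demands cl Γ →
             proj₁ o ∈ cl × Obligation o × Open Γ o
∈-demands⁻ {cl = cl} {Γ} o∈ with o∈′ , op ← ∈-filter⁻ (open? Γ) {xs = concatMap obligations cl} o∈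
                            with c , c∈ , p ← find (∈-concatMap⁻ obligations {xs = cl} o∈′) = go c c∈ p op
  where
  go : ∀ c {o} → c ∈ cl → o ∈ obligations c → Open Γ o → proj₁ o ∈ cl × Obligation o × Open Γ o
  go (a ⇨ b) c∈ (here refl) op = c∈ , imp , op
  go (□ a)   c∈ (here refl) op = c∈ , box , op

Meets : List (Term n) → Term n × Term n × Term n → List (Term n) → Set
Meets Γ (_ , p , q) Δ = Γ ⊆⁺ Δ × p ∈ Δ × q ∉ Δ

meets? : ∀ Γ o (Δ : List (Term n)) → Dec (Meets Γ o Δ)
meets? Γ (_ , p , q) Δ = (Γ ⊆⁺? Δ) ×-dec (p ∈? Δ) ×-dec ¬? (q ∈? Δ)

-- Models on pairs of a world and a type, and their truth lemma.

module Expansion (F : Frame) {I : Set} (is : List I) (type : I → List (Term n))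
                 {R : Frame.World F → I → Set} (R? : ∀ w i → Dec (R w i)) where
  open Frame F

  Succ : World × I → World × I → Set
  Succ (w , i) (v , j) = type i ⊆⁺ type j × R v j

  succ? : ∀ x y → Dec (Succ x y)
  succ? (w , i) (v , j) = (type i ⊆⁺? type j) ×-dec R? v j

  succs⁺ : World × I → List (World × I)
  succs⁺ x = filter (succ? x) (cartesianProduct (succs (proj₁ x)) is)

  ∈-succs⁻ : ∀ {w i v j} → (v , j) ∈ succs⁺ (w , i) → w < v × j ∈ is × Succ (w , i) (v , j)
  ∈-succs⁻ {w} {i} y∈ with y∈′ , p ← ∈-filter⁻ (succ? (w , i)) {xs = cartesianProduct (succs w) is} y∈
                      with w<v , j∈ ← ∈-cartesianProduct⁻ (succs w) is y∈′ = w<v , j∈ , p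

  ∈-succs⁺ : ∀ {w i v j} → w < v → j ∈ is → Succ (w , i) (v , j) → (v , j) ∈ succs⁺ (w , i)
  ∈-succs⁺ {w} {i} w<v j∈ p = ∈-filter⁺ (succ? (w , i)) (∈-cartesianProduct⁺ w<v j∈) p

  -- All pairs are worlds, but `R` is imposed on the targets of the successor relation, so that
  -- paths from a pair in `R` stay in `R`. Completeness uses this over a frame of depths,
  -- interpolation over the frame of a given model.
  expansion : Model n
  expansion = record
    { frame = record
      { World   = World × I
      ; succs   = succs⁺
      ; <-trans = λ {x} {y} x<y y<z →
          let u<v , _  , i⊆j , _ = ∈-succs⁻ x<y
              v<w , k∈ , j⊆k , r = ∈-succs⁻ y<z
          in ∈-succs⁺ (<-trans u<v v<w) k∈ (⊆⁺-trans {Γ = type (proj₂ x)} {Δ = type (proj₂ y)} i⊆j j⊆k , r)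
      ; >-wf    = λ x → acc-proj₁ (>-wf (proj₁ x))
      }
    ; Val         = λ (w , i) x → var x ∈ type i
    ; Val?        = λ (w , i) x → var x ∈? type i
    ; Val-persist = λ {x} x<y p → let _ , _ , i⊆j , _ = ∈-succs⁻ x<y
                                  in All.lookup i⊆j (∈⁺-self {Γ = type (proj₂ x)} p)
    }
    where
    acc-proj₁ : ∀ {x} → Acc (λ v u → u < v) (proj₁ x) → Acc (λ y x → y ∈ succs⁺ x) x
    acc-proj₁ (acc rs) = acc λ y∈ → acc-proj₁ (rs (proj₁ (∈-succs⁻ y∈)))

  module Truth {cl : List (Term n)} (closed : Closed cl)
    (coherent : ∀ {w i} → R w i → ∀ {a} → a ∈ cl → Coherent (type i) a)
    (met : ∀ {w i} → R w i → ∀ {o} → o ∈ demands cl (type i) →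
           ∃[ v ] ∃[ j ] w < v × j ∈ is × Meets (type i) o (type j) × R v j) where

    -- Induction on `a`: coherence settles the pair itself, `⊆⁺` carries members of a type to
    -- successors, and `met` supplies the successor that refutes an absent `⇨` or `□`.
    truth : ∀ a {w i} → R w i → a ∈ cl → (expansion , (w , i) ⊩ a) ⇔ a ∈ type i
    truth (var x) r a∈ = ⇔.refl
    truth ⊥       r a∈ = mk⇔ (λ ()) (coherent r a∈)
    truth (a ∧ b) r a∈ =
      ⇔.trans (truth a r (closed a∈ (here refl)) ×-⇔ truth b r (closed a∈ (there (here refl))))
              (mk⇔ (proj₂ (coherent r a∈)) (proj₁ (coherent r a∈)))
    truth (a ∨ b) r a∈ =
      ⇔.trans (truth a r (closed a∈ (here refl)) ⊎-⇔ truth b r (closed a∈ (there (here refl))))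
              (mk⇔ (proj₂ (coherent r a∈)) (proj₁ (coherent r a∈)))
    truth (a ⇨ b) {w} {i} r c∈ = mk⇔ ⇒ ⇐
      where
      a∈ = closed c∈ (here refl)
      b∈ = closed c∈ (there (here refl))
      ⇒ : expansion , (w , i) ⊩ a ⇨ b → a ⇨ b ∈ type i
      ⇒ f with a ⇨ b ∈? type i | a ∈? type i
      ... | yes p | _     = p
      ... | no _  | yes p = proj₂ (coherent r c∈) p (to (truth b r b∈) (f _ refl (from (truth a r a∈) p)))
      ... | no ¬p | no ¬q with v , j , w<v , j∈ , (i⊆j , p , q) , r′ ← met r (∈-demands⁺ c∈ imp ¬p ¬q) =
        contradiction (to (truth b r′ b∈) (f (v , j) [ ∈-succs⁺ w<v j∈ (i⊆j , r′) ] (from (truth a r′ a∈) p))) q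
      ⇐ : a ⇨ b ∈ type i → expansion , (w , i) ⊩ a ⇨ b
      ⇐ p _ refl      q = from (truth b r b∈) (proj₁ (coherent r c∈) p (to (truth a r a∈) q))
      ⇐ p y [ x<y ] q with _ , _ , i⊆j , r′ ← ∈-succs⁻ x<y =
        from (truth b r′ b∈) (proj₁ (coherent r′ c∈) (All.lookup i⊆j (∈⁺-self p)) (to (truth a r′ a∈) q))
    truth (□ a) {w} {i} r c∈ = mk⇔ ⇒ ⇐
      where
      a∈ = closed c∈ (here refl)
      ⇒ : expansion , (w , i) ⊩ □ a → □ a ∈ type i
      ⇒ f with □ a ∈? type i
      ... | yes p = p
      ... | no ¬p with v , j , w<v , j∈ , (i⊆j , _ , q) , r′ ← met r (∈-demands⁺ c∈ box ¬p ¬p) =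
        contradiction (to (truth a r′ a∈) (f (v , j) (∈-succs⁺ w<v j∈ (i⊆j , r′)))) q
      ⇐ : □ a ∈ type i → expansion , (w , i) ⊩ □ a
      ⇐ p y x<y with _ , _ , i⊆j , r′ ← ∈-succs⁻ x<y =
        from (truth a r′ a∈) (All.lookup i⊆j (∈⁺-unbox p))

-- Subformulas and closed sets of formulas.

subs : Term n → List (Term n)
subs (var x) = var x ∷ []
subs ⊥       = ⊥ ∷ []
subs (a ∧ b) = a ∧ b ∷ subs a ++ subs b
subs (a ∨ b) = a ∨ b ∷ subs a ++ subs b
subs (a ⇨ b) = (a ⇨ b) ∷ subs a ++ subs b
subs (□ a)   = □ a ∷ subs a

self∈subs : (a : Term n) → a ∈ subs a
self∈subs (var _) = here refl
self∈subs ⊥       = here refl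
self∈subs (_ ∧ _) = here refl
self∈subs (_ ∨ _) = here refl
self∈subs (_ ⇨ _) = here refl
self∈subs (□ _)   = here refl

closed-++ : {Γ Δ : List (Term n)} → Closed Γ → Closed Δ → Closed (Γ ++ Δ)
closed-++ {Γ = Γ} clΓ clΔ a∈ b∈ with ∈-++⁻ Γ a∈
... | inj₁ a∈Γ = ∈-++⁺ˡ (clΓ a∈Γ b∈)
... | inj₂ a∈Δ = ∈-++⁺ʳ Γ (clΔ a∈Δ b∈)

closed-∷ : {a : Term n} {Γ : List (Term n)} → (∀ {b} → b ∈ args a → b ∈ Γ) → Closed Γ → Closed (a ∷ Γ)
closed-∷ args⊆ clΓ (here refl) b∈ = there (args⊆ b∈)
closed-∷ args⊆ clΓ (there a∈)  b∈ = there (clΓ a∈ b∈)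

closed-concatMap : ∀ {f : A → List (Term n)} → (∀ x → Closed (f x)) → ∀ xs → Closed (concatMap f xs)
closed-concatMap {f = f} cl (x ∷ xs) = closed-++ {Γ = f x} (cl x) (closed-concatMap cl xs)

args⊆subs : (a b : Term n) → ∀ {c} → c ∈ a ∷ b ∷ [] → c ∈ subs a ++ subs b
args⊆subs a b (here refl)         = ∈-++⁺ˡ (self∈subs a)
args⊆subs a b (there (here refl)) = ∈-++⁺ʳ (subs a) (self∈subs b)

subs-closed : (a : Term n) → Closed (subs a)
subs-closed (var _) (here refl) ()
subs-closed ⊥       (here refl) ()
subs-closed (a ∧ b) = closed-∷ (args⊆subs a b) (closed-++ {Γ = subs a} (subs-closed a) (subs-closed b))
subs-closed (a ∨ b) = closed-∷ (args⊆subs a b) (closed-++ {Γ = subs a} (subs-closed a) (subs-closed b))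
subs-closed (a ⇨ b) = closed-∷ (args⊆subs a b) (closed-++ {Γ = subs a} (subs-closed a) (subs-closed b))
subs-closed (□ a)   = closed-∷ (λ { (here refl) → self∈subs a }) (subs-closed a)

-- Completeness of the free algebra for Kripke models.

module Completeness {n : ℕ} where
  open HeytingAlgebra (KMAlgebra.heytingAlgebra (Free n))
    using (_≤_; maximum; minimum; ∧-greatest; ∨-least; x∧y≤x; x∧y≤y; x≤x∨y; y≤x∨y; transpose-⇨)
    renaming (refl to ≤-refl; trans to ≤-trans; reflexive to ≤-reflexive)
  open HeytingProperties (KMAlgebra.heytingAlgebra (Free n)) using (⇨-eval; y≤x⇨y)

  ⋀-lower : ∀ {a : Term n} {Γ} → a ∈ Γ → ⋀ Γ ≤ a
  ⋀-lower (here refl) = x∧y≤x _ _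
  ⋀-lower (there a∈)  = ≤-trans (x∧y≤y _ _) (⋀-lower a∈)

  ⋁-upper : ∀ {a : Term n} {Γ} → a ∈ Γ → a ≤ ⋁ Γ
  ⋁-upper (here refl) = x≤x∨y _ _
  ⋁-upper (there a∈)  = ≤-trans (⋁-upper a∈) (y≤x∨y _ _)

  -- Both `d` and `a` lie below `c ⇨ d`, hence so does `c`.
  cut : ∀ {c d a : Term n} → c ∧ a ≤ d → c ≤ d ∨ a → c ≤ d
  cut c∧a≤d c≤d∨a = ≤-trans (∧-greatest ≤-refl c≤c⇨d) (≤-trans (∧-greatest (x∧y≤y _ _) (x∧y≤x _ _)) ⇨-eval)
    where c≤c⇨d = ≤-trans c≤d∨a (∨-least y≤x⇨y (transpose-⇨ (≤-trans (∧-greatest (x∧y≤y _ _) (x∧y≤x _ _)) c∧a≤d)))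

  -- A finitary substitute for extension to a prime filter: each entry of `xs` in turn is decided by
  -- a `cut`, and a split records the decisions.
  cuts : ∀ xs {c d : Term n} → (∀ {Γ Δ} → (Γ , Δ) ∈ splits xs → c ∧ ⋀ Γ ≤ d ∨ ⋁ Δ) → c ≤ d
  cuts []       h = ≤-trans (∧-greatest ≤-refl (maximum _)) (≤-trans (h (here refl)) (∨-least ≤-refl (minimum _)))
  cuts (a ∷ xs) h = cut
    (cuts xs λ s → ≤-trans (∧-greatest (≤-trans (x∧y≤x _ _) (x∧y≤x _ _))
                                       (∧-greatest (≤-trans (x∧y≤x _ _) (x∧y≤y _ _)) (x∧y≤y _ _)))
                           (h (∈-++⁺ˡ (∈-map⁺ _ s))))
    (cuts xs λ s → ≤-trans (h (∈-++⁺ʳ _ (∈-map⁺ _ s)))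
                           (∨-least (≤-trans (x≤x∨y _ _) (x≤x∨y _ _))
                                    (∨-least (≤-trans (y≤x∨y _ _) (x≤x∨y _ _)) (y≤x∨y _ _))))

  □-mono : ∀ {a b : Term n} → a ≤ b → □ a ≤ □ b
  □-mono {a} {b} a≤b = trans (□-cong a≤b) (sym (□-∧ a b))

  ⋀≤□⋀ : ∀ {c : Term n} Γ → (∀ {a} → a ∈ Γ → c ≤ □ a) → c ≤ □ ⋀ Γ
  ⋀≤□⋀ []      h = ≤-trans (maximum _) (≤-reflexive (sym □-⊤))
  ⋀≤□⋀ (a ∷ Γ) h = ≤-trans (∧-greatest (h (here refl)) (⋀≤□⋀ Γ (h ∘ there))) (≤-reflexive (□-∧ _ _))

  module _ {cl : List (Term n)} (closed : Closed cl) where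

    -- The recursion index bounds the depth of the countermodel below the type.
    Realised : ℕ → List (Term n) → Set
    Realised zero    Γ = Empty
    Realised (suc k) Γ = All (Coherent Γ) cl ×
                         All (λ o → Any (λ (Δ , _) → Meets Γ o Δ × Realised k Δ) (splits cl)) (demands cl Γ)

    realised? : ∀ k Γ → Dec (Realised k Γ)
    realised? zero    Γ = no λ ()
    realised? (suc k) Γ = all? (coherent? Γ) cl ×-dec
      all? (λ o → any? (λ (Δ , _) → meets? Γ o Δ ×-dec realised? k Δ) (splits cl)) (demands cl Γ)

    -- A world is a recursion index of `Realised`. It sees all smaller numbers, not just its
    -- predecessor, for the sake of transitivity.
    depths : Frame
    depths = record
      { World   = ℕ
      ; succs   = downFrom
      ; <-trans = λ p q → ∈-downFrom⁺ (ℕ.<-trans (∈-downFrom⁻ q) (∈-downFrom⁻ p))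
      ; >-wf    = Subrelation.wellFounded ∈-downFrom⁻ <-wellFounded
      }

    open Expansion depths (map proj₁ (splits cl)) id realised?

    met : ∀ {k Γ} → Realised k Γ → ∀ {o} → o ∈ demands cl Γ →
          ∃[ l ] ∃[ Δ ] l ∈ downFrom k × Δ ∈ map proj₁ (splits cl) × Meets Γ o Δ × Realised l Δ
    met {suc k} (_ , ms) o∈ with (Δ , _) , Δ∈ , m , r ← find (All.lookup ms o∈) =
      k , Δ , ∈-downFrom⁺ ℕ.≤-refl , ∈-map⁺ proj₁ Δ∈ , m , r

    coherent : ∀ {k Γ} → Realised k Γ → ∀ {a} → a ∈ cl → Coherent Γ a
    coherent {suc k} (cs , _) = All.lookup cs

    open Truth closed coherent met

    -- Each way to fail coherence contradicts a Heyting law relating members of `Γ` to formulas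
    -- outside it, and the latter lie in `Δ`.
    incoherent : ∀ {Γ Δ a} → (Γ , Δ) ∈ splits cl → a ∈ cl → ¬ Coherent Γ a → ⋀ Γ ≤ ⋁ Δ
    incoherent {Γ} {Δ} s a∈ ¬coh = go _ a∈ ¬coh
      where
      ∉⇒≤ : ∀ {a} → a ∈ cl → a ∉ Γ → a ≤ ⋁ Δ
      ∉⇒≤ a∈ a∉ = ⋁-upper ([ (λ p → contradiction p a∉) , id ]′ (∈-splits⁺ s a∈))

      go : ∀ a → a ∈ cl → ¬ Coherent Γ a → ⋀ Γ ≤ ⋁ Δ
      go (var _) c∈ ¬coh = contradiction tt ¬coh
      go (□ _)   c∈ ¬coh = contradiction tt ¬coh
      go ⊥       c∈ ¬coh with ⊥ ∈? Γ
      ... | yes p = ≤-trans (⋀-lower p) (minimum _)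
      ... | no ¬p = contradiction ¬p ¬coh
      go (a ∧ b) c∈ ¬coh with a ∧ b ∈? Γ | a ∈? Γ | b ∈? Γ
      ... | yes p | yes q | yes r = contradiction ((λ _ → q , r) , λ _ → p) ¬coh
      ... | yes p | no ¬q | _     = ≤-trans (⋀-lower p) (≤-trans (x∧y≤x _ _) (∉⇒≤ (closed c∈ (here refl)) ¬q))
      ... | yes p | _     | no ¬r = ≤-trans (⋀-lower p) (≤-trans (x∧y≤y _ _) (∉⇒≤ (closed c∈ (there (here refl))) ¬r))
      ... | no ¬p | yes q | yes r = ≤-trans (∧-greatest (⋀-lower q) (⋀-lower r)) (∉⇒≤ c∈ ¬p)
      ... | no ¬p | no ¬q | _     = contradiction ((λ p → contradiction p ¬p) , λ (q , _) → contradiction q ¬q) ¬coh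
      ... | no ¬p | _     | no ¬r = contradiction ((λ p → contradiction p ¬p) , λ (_ , r) → contradiction r ¬r) ¬coh
      go (a ∨ b) c∈ ¬coh with a ∨ b ∈? Γ | a ∈? Γ | b ∈? Γ
      ... | yes p | yes q | _     = contradiction ((λ _ → inj₁ q) , λ _ → p) ¬coh
      ... | yes p | _     | yes r = contradiction ((λ _ → inj₂ r) , λ _ → p) ¬coh
      ... | yes p | no ¬q | no ¬r = ≤-trans (⋀-lower p) (∨-least (∉⇒≤ (closed c∈ (here refl)) ¬q)
                                                                 (∉⇒≤ (closed c∈ (there (here refl))) ¬r))
      ... | no ¬p | yes q | _     = ≤-trans (⋀-lower q) (≤-trans (x≤x∨y _ _) (∉⇒≤ c∈ ¬p))
      ... | no ¬p | _     | yes r = ≤-trans (⋀-lower r) (≤-trans (y≤x∨y _ _) (∉⇒≤ c∈ ¬p))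
      ... | no ¬p | no ¬q | no ¬r = contradiction
        ((λ p → contradiction p ¬p) , [ (λ q → contradiction q ¬q) , (λ r → contradiction r ¬r) ]′) ¬coh
      go (a ⇨ b) c∈ ¬coh with a ⇨ b ∈? Γ | a ∈? Γ | b ∈? Γ
      ... | yes p | _     | yes r = contradiction ((λ _ _ → r) , λ _ _ → p) ¬coh
      ... | yes p | yes q | no ¬r = ≤-trans (∧-greatest (⋀-lower p) (⋀-lower q))
                                            (≤-trans ⇨-eval (∉⇒≤ (closed c∈ (there (here refl))) ¬r))
      ... | _     | no ¬q | _     = contradiction ((λ _ q → contradiction q ¬q) , λ q → contradiction q ¬q) ¬coh
      ... | no ¬p | _     | yes r = ≤-trans (⋀-lower r) (≤-trans y≤x⇨y (∉⇒≤ c∈ ¬p))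
      ... | no ¬p | _     | no ¬r = contradiction ((λ p → contradiction p ¬p) , λ _ r → contradiction r ¬r) ¬coh

    obligation-args : ∀ {c p q} → Obligation (c , p , q) → c ∈ cl → p ∈ cl × q ∈ cl
    obligation-args imp c∈ = closed c∈ (here refl) , closed c∈ (there (here refl))
    obligation-args box c∈ = c∈ , closed c∈ (here refl)

    -- This is where Löb's axiom □ x ⇨ x ≈ x and the axiom □ x ≤ y ∨ (y ⇨ x) enter.
    □⇨≤ : ∀ {c p q} → Obligation (c , p , q) → □ (p ⇨ q) ≤ p ∨ c
    □⇨≤ (imp {a} {b}) = ≤-trans (□x≤y∨y⇨x (a ⇨ b) a)
      (∨-least (x≤x∨y _ _) (≤-trans (transpose-⇨ (≤-trans (∧-greatest ⇨-eval (x∧y≤y _ _)) ⇨-eval)) (y≤x∨y _ _)))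
    □⇨≤ (box {a}) = ≤-trans (≤-reflexive (□-cong (□x⇨x≈x a))) (y≤x∨y _ _)

    -- The list rest contains the formulas that may still be added to Γ.
    unrealised : ∀ k {Γ Δ} → (Γ , Δ) ∈ splits cl → (rest : List (Term n)) →
                 (∀ {a} → a ∈ cl → a ∈ Γ ⊎ a ∈ rest) → length rest ℕ.< k →
                 ¬ Realised k Γ → ⋀ Γ ≤ ⋁ Δ
    unrealised (suc k) {Γ} {Δ} s rest cover (s≤s rest≤k) ¬r with all? (coherent? Γ) cl
    ... | no ¬coh with a , a∈ , ¬c ← find (¬All⇒Any¬ (coherent? Γ) cl ¬coh) = incoherent s a∈ ¬c
    ... | yes coh with (c , p , q) , o∈ , ¬any ← find (¬All⇒Any¬
                         (λ o → any? (λ (Δ , _) → meets? Γ o Δ ×-dec realised? k Δ) (splits cl))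
                         (demands cl Γ) (λ ms → ¬r (coh , ms)))
                  with c∈ , ob , c∉ , p∉ ← ∈-demands⁻ {cl = cl} o∈ =
      -- The chain is `⋀ Γ ≤ □ ⋀ (Γ ⁺) ≤ □ (p ⇨ q) ≤ p ∨ c ≤ ⋁ Δ`. Its second link is proved by cuts
      -- over all candidates `Θ` for the type of a successor.
      ≤-trans (⋀≤□⋀ (Γ ⁺) λ a∈ → [ (λ a∈Γ → ≤-trans (⋀-lower a∈Γ) (x≤□x _)) , ⋀-lower ]′ (∈⁺⁻ {Γ = Γ} a∈))
      (≤-trans (□-mono (transpose-⇨ (cuts cl step)))
      (≤-trans (□⇨≤ ob) (∨-least (∉⇒≤ p∈ p∉) (∉⇒≤ c∈ c∉))))
      where
      p∈ = proj₁ (obligation-args ob c∈)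
      q∈ = proj₂ (obligation-args ob c∈)

      ∉⇒≤ : ∀ {a} → a ∈ cl → a ∉ Γ → a ≤ ⋁ Δ
      ∉⇒≤ a∈ a∉ = ⋁-upper ([ (λ p → contradiction p a∉) , id ]′ (∈-splits⁺ s a∈))

      ⁺⊆cl : ∀ {a} → a ∈ Γ ⁺ → a ∈ cl
      ⁺⊆cl a∈ = [ ∈-splits⁻ s , (λ □a∈ → closed (∈-splits⁻ s □a∈) (here refl)) ]′ (∈⁺⁻ {Γ = Γ} a∈)

      p? : ∀ a → Dec (¬ a ≡ p)
      p? a = ¬? (a ≟ p)

      step : ∀ {Θ Λ} → (Θ , Λ) ∈ splits cl → (⋀ (Γ ⁺) ∧ p) ∧ ⋀ Θ ≤ q ∨ ⋁ Λ
      step {Θ} {Λ} s′ with Γ ⊆⁺? Θ | p ∈? Θ | q ∈? Θ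
      ... | _ | _ | yes q∈Θ = ≤-trans (x∧y≤y _ _) (≤-trans (⋀-lower q∈Θ) (x≤x∨y _ _))
      ... | no Γ⊈Θ | _ | _ with a , a∈ , a∉ ← find (¬All⇒Any¬ (_∈? Θ) (Γ ⁺) Γ⊈Θ) =
        ≤-trans (≤-trans (x∧y≤x _ _) (≤-trans (x∧y≤x _ _) (⋀-lower a∈)))
                (≤-trans (⋁-upper ([ (λ a∈Θ → contradiction a∈Θ a∉) , id ]′ (∈-splits⁺ s′ (⁺⊆cl a∈)))) (y≤x∨y _ _))
      ... | yes _ | no p∉Θ | _ =
        ≤-trans (≤-trans (x∧y≤x _ _) (x∧y≤y _ _))
                (≤-trans (⋁-upper ([ (λ p∈Θ → contradiction p∈Θ p∉Θ) , id ]′ (∈-splits⁺ s′ p∈))) (y≤x∨y _ _))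
      -- Here `Θ` meets the demand, so `¬any` makes it unrealised at depth `k`. It has gained `p`,
      -- which is outside `Γ`; removing `p` shortens `rest`, and the recursion applies.
      ... | yes Γ⊆Θ | yes p∈Θ | no q∉Θ = ≤-trans (x∧y≤y _ _) (≤-trans
        (unrealised k s′ (filter p? rest) cover′
          (ℕ.<-≤-trans (filter-notAll p? rest (lose p∈rest λ p≢p → p≢p refl)) rest≤k)
          (λ r → ¬any (lose s′ ((Γ⊆Θ , p∈Θ , q∉Θ) , r))))
        (y≤x∨y _ _))
        where
        p∈rest = [ (λ p∈Γ → contradiction p∈Γ p∉) , id ]′ (cover p∈)
        cover′ : ∀ {a} → a ∈ cl → a ∈ Θ ⊎ a ∈ filter p? rest
        cover′ {a} a∈ with cover a∈ | a ≟ p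
        ... | _           | yes refl = inj₁ p∈Θ
        ... | inj₁ a∈Γ    | no _     = inj₁ (All.lookup Γ⊆Θ (∈⁺-self a∈Γ))
        ... | inj₂ a∈rest | no a≢p   = inj₂ (∈-filter⁺ p? a∈rest a≢p)

    -- Cuts on all of `cl` leave one candidate type at a time. An unrealised one gives `⋀ Γ ≤ ⋁ Δ`
    -- outright; a realised one is a world of a model, where validity applies.
    complete-closed : ∀ {a b} → a ∈ cl → b ∈ cl → (∀ (M : Model n) w → M , w ⊩ a → M , w ⊩ b) → a ≤ b
    complete-closed {a} {b} a∈ b∈ valid = cuts cl step
      where
      -- `unrealised` starts with `rest = cl` and needs a depth strictly above its length.
      depth = suc (length cl)
      step : ∀ {Γ Δ} → (Γ , Δ) ∈ splits cl → a ∧ ⋀ Γ ≤ b ∨ ⋁ Δ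
      step {Γ} s with realised? depth Γ | a ∈? Γ
      ... | no ¬r | _     = ≤-trans (x∧y≤y _ _) (≤-trans (unrealised depth s cl inj₂ ℕ.≤-refl ¬r) (y≤x∨y _ _))
      ... | yes r | yes p = ≤-trans (x∧y≤y _ _) (≤-trans (⋀-lower b∈Γ) (x≤x∨y _ _))
        where b∈Γ = to (truth b r b∈) (valid expansion (depth , Γ) (from (truth a r a∈) p))
      ... | yes r | no ¬p = ≤-trans (x∧y≤x _ _)
        (≤-trans (⋁-upper ([ (λ p → contradiction p ¬p) , id ]′ (∈-splits⁺ s a∈))) (y≤x∨y _ _))

  complete : ∀ {a b} → (∀ (M : Model n) w → M , w ⊩ a → M , w ⊩ b) → a ≤ b
  complete {a} {b} = complete-closed (closed-++ {Γ = subs a} (subs-closed a) (subs-closed b))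
                                     (∈-++⁺ˡ (self∈subs a)) (∈-++⁺ʳ (subs a) (self∈subs b))

-- Solving guarded systems given by operators that preserve agreement.

Causal : ((Fin k → Term m) → Fin k → Term m) → Set₁
Causal {m = m} F = ∀ (M : Model m) → let open Forcing M in
  ∀ {w z z′} → (∀ i → Agree w (z i) (z′ i)) → ∀ j → Agree w (F z j) (F z′ j)

-- Gaussian elimination.  A single guarded equation x = f (□ x) is solved by
-- x = f (□ f ⊤): wherever □ f ⊤ holds it agrees with ⊤ from there on, so
-- that x and f ⊤ agree, and Löb's rule then gives □ x = □ f ⊤ everywhere.

guarded-fixpoint : ∀ k (F : (Fin k → Term m) → Fin k → Term m) → Causal F →
  ∃[ X ] ∀ (M : Model m) {w} j → Forcing.Agree M w (X j) (F (□_ ∘ X) j)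
guarded-fixpoint         zero    F causal = (λ ()) , λ _ ()
guarded-fixpoint {m = m} (suc k) F causal = X , X-fixed
  where
  -- The first unknown is solved in terms of the others: `□ s z` is the box of its solution, and
  -- putting it in leaves a system in `k` unknowns.
  s : (Fin k → Term m) → Term m
  s z = F ((⊥ ⇨ ⊥) V.∷ z) zero

  ⟨_⟩ : (Fin k → Term m) → Fin (suc k) → Term m
  ⟨ z ⟩ = □ s z V.∷ z

  ⟨⟩-causal : Causal λ z j → F ⟨ z ⟩ (suc j)
  ⟨⟩-causal M e j = causal M (λ { zero    → agree-□ λ w<v → causal M (λ { zero    → agree-refl
                                                                         ; (suc i) → agree-up [ w<v ] (e i) }) zero
                                 ; (suc i) → e i }) (suc j)
    where open Forcing M

  eliminated = guarded-fixpoint k (λ z j → F ⟨ z ⟩ (suc j)) ⟨⟩-causal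

  X′ = proj₁ eliminated
  z  = □_ ∘ X′
  x₀ = F ⟨ z ⟩ zero
  X  = x₀ V.∷ X′

  module _ (M : Model m) where
    open Forcing M

    s∼x₀ : ∀ {w} → w ⊩ □ s z → Agree w (s z) x₀
    s∼x₀ □s = causal M (λ { zero    → agree λ w⊑v → mk⇔ (λ _ → persist (□ s z) w⊑v □s) (λ _ _ _ ())
                          ; (suc i) → agree-refl }) zero

    □x₀∼□s : ∀ {w} → Agree w (□ x₀) (□ s z)
    □x₀∼□s = agree λ _ → mk⇔
      (λ □x → löb (s z) λ v w<v □s → from (at (s∼x₀ □s) refl) (□x v w<v))
      (λ □s v w<v → to (at (s∼x₀ (persist (□ s z) [ w<v ] □s)) refl) (□s v w<v))

    X∼⟨z⟩ : ∀ {w} i → Agree w (⟨ z ⟩ i) (□ X i)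
    X∼⟨z⟩ zero    = agree λ w⊑v → ⇔.sym (at □x₀∼□s w⊑v)
    X∼⟨z⟩ (suc i) = agree-refl

    X-fixed : ∀ {w} j → Agree w (X j) (F (□_ ∘ X) j)
    X-fixed zero    = causal M X∼⟨z⟩ zero
    X-fixed (suc j) = agree λ w⊑v →
      ⇔.trans (at (proj₂ eliminated M j) w⊑v) (at (causal M X∼⟨z⟩ (suc j)) w⊑v)

-- Uniform interpolation

restrict : Model n → (Fin m → Term n) → Model m
restrict M ρ = record
  { frame       = Model.frame M
  ; Val         = λ w y → w ⊩ ρ y
  ; Val?        = λ w y → w ⊩? ρ y
  ; Val-persist = λ {_} {_} {y} u<v → persist (ρ y) [ u<v ]
  }
  where open Forcing M

module _ (M : Model n) (ρ : Fin m → Term n) where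

  restrict-⊩ : ∀ χ {w} → (restrict M ρ , w ⊩ χ) ⇔ (M , w ⊩ χ ⟪ ρ ⟫)
  restrict-⊩ (var y) = ⇔.refl
  restrict-⊩ ⊥       = ⇔.refl
  restrict-⊩ (a ∧ b) = restrict-⊩ a ×-⇔ restrict-⊩ b
  restrict-⊩ (a ∨ b) = restrict-⊩ a ⊎-⇔ restrict-⊩ b
  restrict-⊩ (a ⇨ b) = mk⇔ (λ f v w⊑v p → to   (restrict-⊩ b) (f v w⊑v (from (restrict-⊩ a) p)))
                           (λ f v w⊑v p → from (restrict-⊩ b) (f v w⊑v (to   (restrict-⊩ a) p)))
  restrict-⊩ (□ a)   = mk⇔ (λ f v w<v → to   (restrict-⊩ a) (f v w<v))
                           (λ f v w<v → from (restrict-⊩ a) (f v w<v))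

module Interpolation {n m} (φ : Term n) (ρ : Fin m → Term n) where

  cl : List (Term n)
  cl = subs φ ++ concatMap (subs ∘ ρ) (allFin m)

  closed : Closed cl
  closed = closed-++ {Γ = subs φ} (subs-closed φ) (closed-concatMap (subs-closed ∘ ρ) (allFin m))

  φ∈cl : φ ∈ cl
  φ∈cl = ∈-++⁺ˡ (self∈subs φ)

  ρ∈cl : ∀ y → ρ y ∈ cl
  ρ∈cl y = ∈-++⁺ʳ (subs φ) (∈-concatMap⁺ (subs ∘ ρ) (lose (∈-allFin y) (self∈subs (ρ y))))

  types : List (List (Term n))
  types = filter (λ Γ → all? (coherent? Γ) cl) (map proj₁ (splits cl))

  Index : Set
  Index = Fin (length types)

  is : List Index
  is = allFin (length types)

  type : Index → List (Term n)
  type = lookup types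

  type-coherent : ∀ i {a} → a ∈ cl → Coherent (type i) a
  type-coherent i = All.lookup (proj₂ (∈-filter⁻ (λ Γ → all? (coherent? Γ) cl) {xs = map proj₁ (splits cl)} (∈-lookup i)))

  above : Index → List Index
  above i = filter (λ j → type i ⊆⁺? type j) is

  meeting : Index → Term n × Term n × Term n → List Index
  meeting i o = filter (λ j → meets? (type i) o (type j)) is

  -- Say that a world w of a model over m variables carries the type i if, up
  -- to bisimulation, it has an expansion over n variables whose theory
  -- within cl is type i.  This is so iff w forces pos i and refutes neg i, if
  -- E i stands for □ of "every world from here on carries some type above i"
  -- and A j for □ of "no world from here on carries the type j".

  module Carry (E A : Index → Term m) where

    -- Under the intended reading of `A`: no strict successor carries a type that would meet `o`.
    unmet : Index → Term n × Term n × Term n → Term m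
    unmet i o = ⋀ (map A (meeting i o))

    -- The variables forced must be exactly the `y` with `ρ y` in the type, and no demand may be
    -- unmet. The negative conditions form a separate formula because refuting it at one world is
    -- weaker than forcing its Heyting negation.
    pos neg : Index → Term m
    pos i = ⋀ (map var (filter (λ y → ρ y ∈? type i) (allFin m))) ∧ E i
    neg i = ⋁ (map var (filter (λ y → ¬? (ρ y ∈? type i)) (allFin m))) ∨
            ⋁ (map (unmet i) (demands cl (type i)))

    clause : List Index × List Index → Term m
    clause (ks , ls) = ⋀ (map neg ls) ⇨ ⋁ (map pos ks)

    -- "Every world from here on carries a type in js": the conjunctive normal
    -- form of the disjunction over js of pos j ∧ ¬ neg j.
    cover : List Index → Term m
    cover js = ⋀ (map clause (splits js))

    avoid : Index → Term m
    avoid i = pos i ⇨ neg i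

  module _ {E A E′ A′ : Index → Term m} (M : Model m) {w : Model.World M} where
    open Forcing M
    private
      module C  = Carry E A
      module C′ = Carry E′ A′

    module _ (eE : ∀ i → Agree w (E i) (E′ i)) (eA : ∀ i → Agree w (A i) (A′ i)) where

      pos-cong : ∀ i → Agree w (C.pos i) (C′.pos i)
      pos-cong i = agree-∧ agree-refl (eE i)

      neg-cong : ∀ i → Agree w (C.neg i) (C′.neg i)
      neg-cong i = agree-∨ agree-refl (agree-⋁ (λ o → agree-⋀ eA (meeting i o)) (demands cl (type i)))

      cover-cong : ∀ js → Agree w (C.cover js) (C′.cover js)
      cover-cong js = agree-⋀ (λ (ks , ls) → agree-⇨ (agree-⋀ neg-cong ls) (agree-⋁ pos-cong ks)) (splits js)

      avoid-cong : ∀ i → Agree w (C.avoid i) (C′.avoid i)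
      avoid-cong i = agree-⇨ (pos-cong i) (neg-cong i)

  K : ℕ
  K = length types

  -- `E` and `A` depend on each other through `cover` and `avoid`; listing `E` before `A` makes this
  -- one system. The argument `z` holds the boxed unknowns.
  system : (Fin (K ℕ.+ K) → Term m) → Fin (K ℕ.+ K) → Term m
  system z = [ cover ∘ above , avoid ]′ ∘ splitAt K
    where open Carry (λ i → z (i ↑ˡ K)) (λ i → z (K ↑ʳ i))

  system-causal : Causal system
  system-causal M e j with splitAt K j
  ... | inj₁ i = cover-cong M (λ i → e (i ↑ˡ K)) (λ i → e (K ↑ʳ i)) (above i)
  ... | inj₂ i = avoid-cong M (λ i → e (i ↑ˡ K)) (λ i → e (K ↑ʳ i)) i

  X : Fin (K ℕ.+ K) → Term m
  X = proj₁ (guarded-fixpoint (K ℕ.+ K) system system-causal)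

  open Carry (λ i → □ X (i ↑ˡ K)) (λ i → □ X (K ↑ʳ i))

  interpolant : Term m
  interpolant = cover (filter (λ i → φ ∈? type i) is)

  -- The types carried by a world.

  module Carrying (M : Model m) where
    open Model M
    open Forcing M

    X-above : ∀ {w} i → (w ⊩ X (i ↑ˡ K)) ⇔ (w ⊩ cover (above i))
    X-above {w} i = ≡.subst (λ s → (w ⊩ X (i ↑ˡ K)) ⇔ (w ⊩ [ cover ∘ above , avoid ]′ s)) (Fin.splitAt-↑ˡ K i K)
      (at (proj₂ (guarded-fixpoint (K ℕ.+ K) system system-causal) M (i ↑ˡ K)) refl)

    X-avoid : ∀ {w} i → (w ⊩ X (K ↑ʳ i)) ⇔ (w ⊩ avoid i)
    X-avoid {w} i = ≡.subst (λ s → (w ⊩ X (K ↑ʳ i)) ⇔ (w ⊩ [ cover ∘ above , avoid ]′ s)) (Fin.splitAt-↑ʳ K K i)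
      (at (proj₂ (guarded-fixpoint (K ℕ.+ K) system system-causal) M (K ↑ʳ i)) refl)

    Carries : World → Index → Set
    Carries w i = w ⊩ pos i × ¬ w ⊩ neg i

    carries? : ∀ w i → Dec (Carries w i)
    carries? w i = (w ⊩? pos i) ×-dec ¬? (w ⊩? neg i)

    ⊩-cover⁺ : ∀ {w} js → (∀ v → w ⊑ v → ∃[ j ] j ∈ js × Carries v j) → w ⊩ cover js
    ⊩-cover⁺ js h = ⊩⋀⁺ clause λ s v w⊑v negs → case (h v w⊑v) s negs
      where
      case : ∀ {v ks ls} → ∃[ j ] j ∈ js × Carries v j → (ks , ls) ∈ splits js →
             v ⊩ ⋀ (map neg ls) → v ⊩ ⋁ (map pos ks)
      case (j , j∈ , p , ¬q) s negs with ∈-splits⁺ s j∈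
      ... | inj₁ j∈ks = ⊩⋁⁺ pos j∈ks p
      ... | inj₂ j∈ls = contradiction (⊩⋀⁻ neg negs j∈ls) ¬q

    -- One clause suffices, that of the split separating the `j` with `neg j` refuted at `w` from
    -- the others. Its premise holds, so `pos j` holds for some `j` with `neg j` refuted.
    ⊩-cover⁻ : ∀ {w} js → w ⊩ cover js → ∃[ j ] j ∈ js × Carries w j
    ⊩-cover⁻ {w} js p =
      let q? = λ j → ¬? (w ⊩? neg j)
          r? = λ j → ¬? (q? j)
          j , j∈ , q = ⊩⋁⁻ pos (⊩⋀⁻ clause p (filter∈splits q? js) w refl
                         (⊩⋀⁺ neg λ {l} l∈ → decidable-stable (w ⊩? neg l) (proj₂ (∈-filter⁻ r? {xs = js} l∈))))
          j∈js , ¬neg = ∈-filter⁻ q? {xs = js} j∈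
      in j , j∈js , q , ¬neg

  -- Worlds of a restricted model carry their own theories.

  module _ (M : Model n) where
    open Model M
    open Forcing M
    open Carrying (restrict M ρ)
    private module ↾ = Forcing (restrict M ρ)

    theory : World → List (Term n)
    theory w = filter (w ⊩?_) cl

    theory∈types : ∀ w → theory w ∈ types
    theory∈types w = ∈-filter⁺ (λ Γ → all? (coherent? Γ) cl) (∈-map⁺ proj₁ (filter∈splits (w ⊩?_) cl))
                               (All.tabulate λ {a} → coherent a)
      where
      th : ∀ {a} → a ∈ cl → w ⊩ a → a ∈ theory w
      th = ∈-filter⁺ (w ⊩?_)
      ht : ∀ {a} → a ∈ theory w → w ⊩ a
      ht p = proj₂ (∈-filter⁻ (w ⊩?_) {xs = cl} p)
      coherent : ∀ a → a ∈ cl → Coherent (theory w) a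
      coherent (var _) c∈ = tt
      coherent (□ _)   c∈ = tt
      coherent ⊥       c∈ = ht
      coherent (a ∧ b) c∈ = (λ p → th a∈ (proj₁ (ht p)) , th b∈ (proj₂ (ht p))) ,
                            (λ (p , q) → th c∈ (ht p , ht q))
        where
        a∈ = closed c∈ (here refl)
        b∈ = closed c∈ (there (here refl))
      coherent (a ∨ b) c∈ = (λ p → Sum.map (th (closed c∈ (here refl))) (th (closed c∈ (there (here refl)))) (ht p)) ,
                            (λ p → th c∈ (Sum.map ht ht p))
      coherent (a ⇨ b) c∈ = (λ f p → th (closed c∈ (there (here refl))) (ht f w refl (ht p))) ,
                            (λ _ q → th c∈ λ v w⊑v _ → persist b w⊑v (ht q))

    index : World → Index
    index w = Any.index (theory∈types w)

    ∈-index : ∀ {w a} → a ∈ type (index w) ⇔ (a ∈ cl × w ⊩ a)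
    ∈-index {w} {a} = ≡.subst (λ Γ → a ∈ Γ ⇔ (a ∈ cl × w ⊩ a)) (Any.lookup-index (theory∈types w))
      (mk⇔ (∈-filter⁻ (w ⊩?_)) (λ (a∈ , p) → ∈-filter⁺ (w ⊩?_) a∈ p))

    index-< : ∀ {w v} → w < v → type (index w) ⊆⁺ type (index v)
    index-< {w} {v} w<v = All.tabulate λ a∈ → [ self , unboxed ]′ (∈⁺⁻ {Γ = type (index w)} a∈)
      where
      self : ∀ {a} → a ∈ type (index w) → a ∈ type (index v)
      self {a} p = let a∈ , q = to ∈-index p in from ∈-index (a∈ , persist a [ w<v ] q)
      unboxed : ∀ {a} → □ a ∈ type (index w) → a ∈ type (index v)
      unboxed p = let □a∈ , q = to ∈-index p in from ∈-index (closed □a∈ (here refl) , q v w<v)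

    demand-met : ∀ {w o} → o ∈ demands cl (type (index w)) →
                 ∃[ v ] w < v × Meets (type (index w)) o (type (index v))
    demand-met {w} o∈ with c∈ , ob , c∉ , p∉ ← ∈-demands⁻ {cl = cl} o∈ = go ob c∈ c∉ p∉
      where
      go : ∀ {c p q} → Obligation (c , p , q) → c ∈ cl → c ∉ type (index w) → p ∉ type (index w) →
           ∃[ v ] w < v × Meets (type (index w)) (c , p , q) (type (index v))
      go (imp {a} {b}) c∈ c∉ p∉ with ⊮⇨⇒ a b (λ p → c∉ (from ∈-index (c∈ , p)))
      -- The witness is strictly above `w`, because `a` fails at `w`.
      ... | v , refl , p , _ = contradiction (from ∈-index (closed c∈ (here refl) , p)) p∉
      ... | v , [ w<v ] , p , ¬q =
        v , w<v , index-< w<v , from ∈-index (closed c∈ (here refl) , p) , λ q → ¬q (proj₂ (to ∈-index q))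
      go (box {a}) c∈ c∉ p∉ with v , w<v , p , ¬q ← ⊮□⇒maximal a (λ p → c∉ (from ∈-index (c∈ , p))) =
        v , w<v , index-< w<v , from ∈-index (c∈ , p) , λ q → ¬q (proj₂ (to ∈-index q))

    -- Induction along `>-wf`: apart from variables, carrying a type depends only on the types
    -- carried by strict successors.
    carries-index : ∀ w → Carries w (index w)
    carries-index w = go (>-wf w)
      where
      go : ∀ {w} → Acc (λ v u → u < v) w → Carries w (index w)
      go {w} (acc rs) = (↾.⊩⋀⁺ var vars , λ v w<v → from (X-above (index w)) (⊩-cover⁺ (above (index w)) (covered w<v))) ,
                        [ ¬vars , ¬avoids ]′
        where
        p? = λ y → ρ y ∈? type (index w)

        vars : ∀ {y} → y ∈ filter p? (allFin m) → w ⊩ ρ y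
        vars y∈ = proj₂ (to ∈-index (proj₂ (∈-filter⁻ p? {xs = allFin m} y∈)))

        covered : ∀ {v} → w < v → ∀ u → v ⊑ u → ∃[ j ] j ∈ above (index w) × Carries u j
        covered w<v u v⊑u = let w<u = <-⊑-trans w<v v⊑u in
          index u , ∈-filter⁺ (λ j → type (index w) ⊆⁺? type j) (∈-allFin (index u)) (index-< w<u) , go (rs w<u)

        ¬vars : ¬ (restrict M ρ , w ⊩ ⋁ (map var (filter (¬? ∘ p?) (allFin m))))
        ¬vars p = let y , y∈ , q = ↾.⊩⋁⁻ var p in
          proj₂ (∈-filter⁻ (¬? ∘ p?) {xs = allFin m} y∈) (from ∈-index (ρ∈cl y , q))

        ¬avoids : ¬ (restrict M ρ , w ⊩ ⋁ (map (unmet (index w)) (demands cl (type (index w)))))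
        ¬avoids p =
          let o , o∈ , q = ↾.⊩⋁⁻ (unmet (index w)) p
              v , w<v , meets = demand-met o∈
              j∈ = ∈-filter⁺ (λ j → meets? (type (index w)) o (type j)) (∈-allFin (index v)) meets
              r , ¬s = go (rs w<v)
          -- If the demand counted as unmet, `v` would avoid its own index, against the induction
          -- hypothesis.
          in ¬s (to (X-avoid (index v)) (↾.⊩⋀⁻ (λ i → □ X (K ↑ʳ i)) q j∈ v w<v) v refl r)

    ⊩-interpolant : ∀ {w} → w ⊩ φ → restrict M ρ , w ⊩ interpolant
    ⊩-interpolant {w} p = ⊩-cover⁺ (filter (λ i → φ ∈? type i) is) λ v w⊑v →
      index v , ∈-filter⁺ (λ i → φ ∈? type i) (∈-allFin (index v)) (from ∈-index (φ∈cl , persist φ w⊑v p)) ,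
      carries-index v

  -- Expanding a model of the interpolant to a model of `φ`.

  module _ (M : Model m) where
    open Model M
    open Forcing M
    open Carrying M
    open Expansion frame is type carries?

    -- As `neg i` is refuted, so is `unmet i o`. Hence the box of avoidance fails for some `j` that
    -- meets `o`, and unwinding this gives a strict successor carrying `j`.
    met : ∀ {w i} → Carries w i → ∀ {o} → o ∈ demands cl (type i) →
          ∃[ v ] ∃[ j ] w < v × j ∈ is × Meets (type i) o (type j) × Carries v j
    met {w} {i} (_ , ¬neg) {o} o∈
      with j , j∈ , ¬avoid ← find (¬All⇒Any¬ (λ j → w ⊩? □ X (K ↑ʳ j)) (meeting i o)
             λ ps → ¬neg (inj₂ (⊩⋁⁺ (unmet i) o∈ (⊩⋀⁺ (λ i → □ X (K ↑ʳ i)) (All.lookup ps)))))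
      with v , w<v , ¬avoid′ ← ⊮□⇒ (X (K ↑ʳ j)) ¬avoid
      with u , v⊑u , p , ¬q ← ⊮⇨⇒ (pos j) (neg j) (¬avoid′ ∘ from (X-avoid j)) =
      u , j , <-⊑-trans w<v v⊑u , ∈-allFin j ,
      proj₂ (∈-filter⁻ (λ j → meets? (type i) o (type j)) {xs = is} j∈) , p , ¬q

    open Truth closed (λ {_} {i} _ → type-coherent i) met

    carries-< : ∀ {w v i} → Carries w i → w < v → ∃[ j ] (v , j) ∈ succs⁺ (w , i) × Carries v j
    carries-< {w} {v} {i} ((_ , p) , _) w<v =
      let j , j∈ , r = ⊩-cover⁻ (above i) (to (X-above i) (p v w<v))
      in j , ∈-succs⁺ w<v (∈-allFin j) (proj₂ (∈-filter⁻ (λ j → type i ⊆⁺? type j) {xs = is} j∈) , r) , r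

    -- On carried pairs, projection to the world is a bisimulation: the truth lemma handles
    -- variables, and `carries-<` lifts successors.
    transfer : ∀ χ {w i} → Carries w i → (w ⊩ χ) ⇔ (expansion , (w , i) ⊩ χ ⟪ ρ ⟫)
    transfer (var y) {w} {i} r@((vars , _) , ¬neg) = ⇔.trans (mk⇔ ⇒ ⇐) (⇔.sym (truth (ρ y) r (ρ∈cl y)))
      where
      p? = λ y → ρ y ∈? type i
      ⇒ : w ⊩ var y → ρ y ∈ type i
      ⇒ p = decidable-stable (p? y) λ ¬q → ¬neg (inj₁ (⊩⋁⁺ var (∈-filter⁺ (¬? ∘ p?) (∈-allFin y) ¬q) p))
      ⇐ : ρ y ∈ type i → w ⊩ var y
      ⇐ q = ⊩⋀⁻ var vars (∈-filter⁺ p? (∈-allFin y) q)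
    transfer ⊥       r = ⇔.refl
    transfer (a ∧ b) r = transfer a r ×-⇔ transfer b r
    transfer (a ∨ b) r = transfer a r ⊎-⇔ transfer b r
    transfer (a ⇨ b) {w} {i} r = mk⇔ ⇒ ⇐
      where
      ⇒ : w ⊩ a ⇨ b → expansion , (w , i) ⊩ (a ⇨ b) ⟪ ρ ⟫
      ⇒ f _       refl    p = to (transfer b r) (f w refl (from (transfer a r) p))
      ⇒ f (v , j) [ x<y ] p = let w<v , _ , _ , r′ = ∈-succs⁻ x<y in
        to (transfer b r′) (f v [ w<v ] (from (transfer a r′) p))
      ⇐ : expansion , (w , i) ⊩ (a ⇨ b) ⟪ ρ ⟫ → w ⊩ a ⇨ b
      ⇐ f _ refl    p = from (transfer b r) (f _ refl (to (transfer a r) p))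
      ⇐ f v [ w<v ] p = let j , x<y , r′ = carries-< r w<v in
        from (transfer b r′) (f _ [ x<y ] (to (transfer a r′) p))
    transfer (□ a) {w} {i} r = mk⇔ ⇒ ⇐
      where
      ⇒ : w ⊩ □ a → expansion , (w , i) ⊩ (□ a) ⟪ ρ ⟫
      ⇒ f (v , j) x<y = let w<v , _ , _ , r′ = ∈-succs⁻ x<y in to (transfer a r′) (f v w<v)
      ⇐ : expansion , (w , i) ⊩ (□ a) ⟪ ρ ⟫ → w ⊩ □ a
      ⇐ f v w<v = let j , x<y , r′ = carries-< r w<v in from (transfer a r′) (f _ x<y)

    expand : ∀ {w} → w ⊩ interpolant →
             Σ[ M′ ∈ Model n ] ∃[ w′ ] M′ , w′ ⊩ φ × ∀ χ → (w ⊩ χ) ⇔ (M′ , w′ ⊩ χ ⟪ ρ ⟫)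
    expand {w} p =
      let i , i∈ , r = ⊩-cover⁻ (filter (λ i → φ ∈? type i) is) p
          φ∈ = proj₂ (∈-filter⁻ (λ i → φ ∈? type i) {xs = is} i∈)
      in expansion , (w , i) , from (truth φ r φ∈cl) φ∈ , λ χ → transfer χ r

-- Finite presentations as single formulas.

_↔_ : Term n → Term n → Term n
s ↔ t = (s ⇨ t) ∧ (t ⇨ s)

module Presentation {n : ℕ} (E : List (Term n × Term n)) where

  Relator : Rel (Term n) 0ℓ
  Relator s t = (s , t) ∈ E

  relations : Term n
  relations = ⋀ (map (uncurry _↔_) E)

  Cg⇒agree : ∀ {s t} → Cg (Free n) Relator s t →
             ∀ (M : Model n) {w} → M , w ⊩ relations → Forcing.Agree M w s t
  Cg⇒agree {s} {t} e M = go e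
    where
    open Forcing M
    go : ∀ {s t w} → Cg (Free n) Relator s t → w ⊩ relations → Agree w s t
    go (gen st∈)    p = agree λ w⊑v → let f , g = ⊩⋀⁻ (uncurry _↔_) p st∈
                                      in mk⇔ (f _ w⊑v) (g _ w⊑v)
    go (incl e)     p = agree-≋ e
    go (sym e)      p = agree λ w⊑v → ⇔.sym (at (go e p) w⊑v)
    go (trans e f)  p = agree λ w⊑v → ⇔.trans (at (go e p) w⊑v) (at (go f p) w⊑v)
    go (∧-cong e f) p = agree-∧ (go e p) (go f p)
    go (∨-cong e f) p = agree-∨ (go e p) (go f p)
    go (⇨-cong e f) p = agree-⇨ (go e p) (go f p)
    go (□-cong e)   p = agree-□ λ w<v → go e (persist relations [ w<v ] p)

  private
    module Q = HeytingAlgebra (KMAlgebra.heytingAlgebra (Free n / Relator))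

  ⊤≤relations : (⊥ ⇨ ⊥) Q.≤ relations
  ⊤≤relations = go E id
    where
    go : ∀ E′ → (∀ {st} → st ∈ E′ → st ∈ E) → (⊥ ⇨ ⊥) Q.≤ ⋀ (map (uncurry _↔_) E′)
    go []       _  = Q.refl
    go (_ ∷ E′) ⊆E = Q.∧-greatest
      (Q.∧-greatest (Q.transpose-⇨ (Q.trans (Q.x∧y≤y _ _) (Q.reflexive (gen (⊆E (here refl))))))
                    (Q.transpose-⇨ (Q.trans (Q.x∧y≤y _ _) (Q.reflexive (sym (gen (⊆E (here refl))))))))
      (go E′ (⊆E ∘ there))

  -- Completeness gives `relations ∧ a ≤ b` in the free algebra, and `relations` becomes `⊤` in the
  -- quotient.
  agree⇒Cg : ∀ {s t} → (∀ (M : Model n) {w} → M , w ⊩ relations → Forcing.Agree M w s t) →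
             Cg (Free n) Relator s t
  agree⇒Cg {s} {t} h = Q.antisym (le λ M p → to (Forcing.at (h M p) refl)) (le λ M p → from (Forcing.at (h M p) refl))
    where
    le : ∀ {a b} → (∀ (M : Model n) {w} → M , w ⊩ relations → M , w ⊩ a → M , w ⊩ b) → a Q.≤ b
    le valid = Q.trans (Q.∧-greatest (Q.trans (Q.maximum _) ⊤≤relations) Q.refl)
                     (incl (Completeness.complete λ M w (p , q) → valid M p q))

-- The kernel of substitution is generated by one equation.

module Kernel {n m} (E : List (Term n × Term n)) (ρ : Fin m → Term n) where
  open Presentation E
  open Interpolation relations ρ

  E′ : List (Term m × Term m)
  E′ = (interpolant , ⊥ ⇨ ⊥) ∷ []

  module P′ = Presentation E′

  -- A world forcing `interpolant` has, along `ρ`, the theory of a world forcing `relations`, where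
  -- the two substituted terms agree.
  Cg-⟪⟫⇒Cg : ∀ {s t} → Cg (Free n) Relator (s ⟪ ρ ⟫) (t ⟪ ρ ⟫) → Cg (Free m) P′.Relator s t
  Cg-⟪⟫⇒Cg {s} {t} e = P′.agree⇒Cg λ M ((_ , ⊤⇒ψ) , _) → Forcing.agree λ w⊑v →
    let M′ , w′ , p , tr = expand M (⊤⇒ψ _ w⊑v λ _ _ ())
    in ⇔.trans (tr s) (⇔.trans (Forcing.at (Cg⇒agree e M′ p) refl) (⇔.sym (tr t)))

  -- The restriction of a model of `relations` forces `interpolant`, so the new presentation is
  -- sound there.
  Cg⇒Cg-⟪⟫ : ∀ {s t} → Cg (Free m) P′.Relator s t → Cg (Free n) Relator (s ⟪ ρ ⟫) (t ⟪ ρ ⟫)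
  Cg⇒Cg-⟪⟫ {s} {t} e = agree⇒Cg λ M p → Forcing.agree λ w⊑v →
    let holds = ((λ _ _ _ _ _ ()) , λ v w⊑v _ → ⊩-interpolant M (Forcing.persist M relations w⊑v p)) , λ _ _ ()
    in ⇔.trans (⇔.sym (restrict-⊩ M ρ s)) (⇔.trans (Forcing.at (P′.Cg⇒agree e (restrict M ρ) holds) w⊑v) (restrict-⊩ M ρ t))

-- Coherence: presenting a finitely generated subalgebra.

corollary1 : {c ℓ p : Level} (A : KMAlgebra c ℓ) → FinitelyPresented A →
    (S : Subalgebra A p) → FinitelyGenerated (subalgebra A S) →
    FinitelyPresented (subalgebra A S)
corollary1 A (n , E , iso) S (xs , generated) = length xs , E′ , record
  { ⟦_⟧              = repr
  ; isKMHomomorphism = record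
    { cong   = λ {x} {y} x≈y → represents y (A.trans (eval-repr x) x≈y)
    ; ⊥-homo = represents⁻ B.⊥ A.refl
    ; ∧-homo = λ x y → represents⁻ (x B.∧ y) (A.sym (A.∧-cong (eval-repr x) (eval-repr y)))
    ; ∨-homo = λ x y → represents⁻ (x B.∨ y) (A.sym (A.∨-cong (eval-repr x) (eval-repr y)))
    ; ⇨-homo = λ x y → represents⁻ (x B.⇨ y) (A.sym (A.⇨-cong (eval-repr x) (eval-repr y)))
    ; □-homo = λ x → represents⁻ (B.□ x) (A.sym (A.□-cong (eval-repr x)))
    }
  ; bijective = (λ {x} {y} e → A.trans (A.sym (eval-repr x)) (A.trans (Cg⇒≈ e) (eval-repr y)))
              , (λ t → eval t , λ {x} x≈ → ≈⇒Cg (A.trans (eval-repr x) x≈))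
  }
  where
  module B = KMAlgebra (subalgebra A S)
  module A where
    open KMAlgebra A public using (_≈_)
    open KMEquations (toEquations (KMAlgebra.isKMAlgebra A)) public using (isLattice; ⇨-cong; □-cong)
    open IsLattice isLattice public using (refl; sym; trans; ∧-cong; ∨-cong)

  open _≅_ iso using (⟦_⟧; isKMHomomorphism; bijective)
  open IsKMHomomorphism isKMHomomorphism using (cong; ⊥-homo; ∧-homo; ∨-homo; ⇨-homo; □-homo)

  ρ : Fin (length xs) → Term n
  ρ y = ⟦ proj₁ (lookup xs y) ⟧

  open Presentation E using (Relator)
  open Kernel E ρ

  eval : Term (length xs) → B.Carrier
  eval (var y) = lookup xs y
  eval ⊥       = B.⊥
  eval (a ∧ b) = eval a B.∧ eval b
  eval (a ∨ b) = eval a B.∨ eval b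
  eval (a ⇨ b) = eval a B.⇨ eval b
  eval (□ a)   = B.□ eval a

  value : Term (length xs) → KMAlgebra.Carrier A
  value t = proj₁ (eval t)

  -- Identifies evaluation at the generators with substitution of `ρ`, so that `Kernel` describes
  -- the kernel of `eval`.
  ⟦eval⟧ : ∀ t → Cg (Free n) Relator ⟦ value t ⟧ (t ⟪ ρ ⟫)
  ⟦eval⟧ (var y) = incl refl
  ⟦eval⟧ ⊥       = ⊥-homo
  ⟦eval⟧ (a ∧ b) = trans (∧-homo _ _) (∧-cong (⟦eval⟧ a) (⟦eval⟧ b))
  ⟦eval⟧ (a ∨ b) = trans (∨-homo _ _) (∨-cong (⟦eval⟧ a) (⟦eval⟧ b))
  ⟦eval⟧ (a ⇨ b) = trans (⇨-homo _ _) (⇨-cong (⟦eval⟧ a) (⟦eval⟧ b))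
  ⟦eval⟧ (□ a)   = trans (□-homo _) (□-cong (⟦eval⟧ a))

  ≈⇒Cg : ∀ {s t} → value s A.≈ value t → Cg (Free (length xs)) P′.Relator s t
  ≈⇒Cg {s} {t} e = Cg-⟪⟫⇒Cg (trans (sym (⟦eval⟧ s)) (trans (cong e) (⟦eval⟧ t)))

  Cg⇒≈ : ∀ {s t} → Cg (Free (length xs)) P′.Relator s t → value s A.≈ value t
  Cg⇒≈ {s} {t} e = proj₁ bijective (trans (⟦eval⟧ s) (trans (Cg⇒Cg-⟪⟫ e) (sym (⟦eval⟧ t))))

  term : ∀ {x} → Generated (subalgebra A S) (λ y → Any (y B.≈_) xs) x → Σ[ t ∈ Term (length xs) ] value t A.≈ proj₁ x
  term (gen y∈)    = var (Any.index y∈) , A.sym (Any.lookup-index y∈)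
  term (resp e g)  = let t , p = term g in t , A.trans p e
  term ⊥-gen       = ⊥ , A.refl
  term (∧-gen g h) = let s , p = term g ; t , q = term h in s ∧ t , A.∧-cong p q
  term (∨-gen g h) = let s , p = term g ; t , q = term h in s ∨ t , A.∨-cong p q
  term (⇨-gen g h) = let s , p = term g ; t , q = term h in s ⇨ t , A.⇨-cong p q
  term (□-gen g)   = let t , p = term g in □ t , A.□-cong p

  -- The isomorphism runs from the subalgebra to the quotient, so a term is read off each derivation
  -- of generation. By `≈⇒Cg` the choice is immaterial modulo the congruence.
  repr : B.Carrier → Term (length xs)
  repr x = proj₁ (term (generated x))

  eval-repr : ∀ x → value (repr x) A.≈ proj₁ x
  eval-repr x = proj₂ (term (generated x))

  represents : ∀ {t} x → value t A.≈ proj₁ x → Cg (Free (length xs)) P′.Relator t (repr x)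
  represents x e = ≈⇒Cg (A.trans e (A.sym (eval-repr x)))

  represents⁻ : ∀ {t} x → proj₁ x A.≈ value t → Cg (Free (length xs)) P′.Relator (repr x) t
  represents⁻ x e = ≈⇒Cg (A.trans (eval-repr x) e)
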